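{- Let $a, c \in \mathbb{N}$ and $b, d \in \mathbb{Z}$. (i) Suppose $a\neq c$. Then $\chi(G_{a,b,c,d}) \le \left\lceil \frac{\log \alpha\beta}{\log\alpha}\right\rceil$ for any real numbers $1<\alpha<\beta$ satisfying $R_{a,b,c,d}\subseteq (\beta^{ -1},\alpha^{ -1})\cup(\alpha,\beta)$. (ii) Suppose $a=c$. If there exists a prime $p$ with $v_p(a)>\max\{v_p(b),v_p(d)\}$ and $v_p(b)=v_p(d)$, then $\chi(G_{a,b,c,d})\le p^{v_p(b-d)}(p-1)$. (iii) Suppose $a=c$. If there exists a prime $p$ with $v_p(a)>\max\{v_p(b),v_p(d)\}$ and $v_p(b)\neq v_p(d)$, then $\chi(G_{a,b,c,d})=2$.
   Context: $\mathbb{N}=\{1,2,\dots\}$. For $a,c\in\mathbb{N}$, $b,d\in\mathbb{Z}$, $R_{a,b,c,d} := \left\{ \frac{an+b}{cn+d} : n \in \mathbb{N} \right\} \cap (\mathbb{Q}_{>0}\setminus\{1\})$. For non-empty $R\subseteq\mathbb{Q}_{>0}\setminus\{1\}$, $G(R)$ is the graph with vertex set $\mathbb{N}$ and edge set $\{\{m,n\}: m/n\in R\}$; $G_{a,b,c,d}:=G(R_{a,b,c,d})$. $\chi$ denotes chromatic number, $v_p$ the $p$-adic valuation (with $v_p(0)=\infty$). -}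

module Defs where

open import Algebra.Bundles using (CommutativeRing)
open import Data.Empty using (⊥-elim)
open import Data.Fin.Base using (Fin)
open import Data.Integer.Base as ℤ using (ℤ; +_; +[1+_]; -[1+_])
import Data.Integer.Properties as ℤ
open import Data.Nat.Base as ℕ using (ℕ; zero; suc)
open import Data.Nat.Divisibility using (_∣?_)
import Data.Nat.Properties as ℕ
open import Data.Product using (Σ; ∃; ∃-syntax; _×_; _,_; proj₁; proj₂)
open import Data.Rational as ℚ
  using (ℚ; mkℚ; 0ℚ; 1ℚ; ½; _+_; _*_; _-_; -_; _<_; _≤_; _/_; _÷_; 1/_; toℚᵘ;
         positive; nonNegative)
open import Data.Rational.Properties as ℚ using
  (≤-refl; ≤-trans; ≤-reflexive; <⇒≤; <-trans; <-≤-trans; ≤-<-trans; <-irrefl;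
   ≰⇒>; ≮⇒≥; <-dense)
open import Data.Rational.Solver using (module +-*-Solver)
import Data.Rational.Unnormalised.Base as ℚᵘ
import Data.Rational.Unnormalised.Properties as ℚᵘ
open import Data.Sum.Base using (_⊎_; inj₁; inj₂; map; swap)
open import Level using (0ℓ)
open import Relation.Binary.Construct.Add.Supremum.Strict ℕ._<_ using (_<⁺_) public
open import Relation.Binary.PropositionalEquality
open import Relation.Nullary.Construct.Add.Supremum using (_⁺; ⊤⁺; [_]) public
open import Relation.Nullary.Decidable using (yes; no)
open import Relation.Nullary.Negation using (¬_)
open import Relation.Unary using (Pred)

open import Algebra.Properties.CommutativeSemiring.Exp
  (CommutativeRing.commutativeSemiring ℚ.+-*-commutativeRing)
  using (_^_; ^-assocʳ; ^-distrib-*)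

open +-*-Solver using (solve; _:+_; _:*_; _:-_; :-_; _:=_; con)

ι : ℤ → ℚ
ι z = z / 1

private
  variable
    p q r p′ q′ : ℚ

module ℚ-Lemmas where

  ≤-by : ∀ e → 0ℚ ≤ e → q ≡ p + e → p ≤ q
  ≤-by {p = p} e 0≤e eq = subst₂ _≤_ (ℚ.+-identityʳ p) (sym eq) (ℚ.+-monoʳ-≤ p 0≤e)

  <-by : ∀ e → 0ℚ < e → q ≡ p + e → p < q
  <-by {p = p} e 0<e eq = subst₂ _<_ (ℚ.+-identityʳ p) (sym eq) (ℚ.+-monoʳ-< p 0<e)

  p≡q+[p-q] : ∀ p q → p ≡ q + (p - q)
  p≡q+[p-q] = solve 2 (λ p q → p := q :+ (p :- q)) refl

  q-p+p≡q : ∀ q p → q - p + p ≡ q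
  q-p+p≡q = solve 2 (λ q p → q :- p :+ p := q) refl

  p-[p-q]≡q : ∀ p q → p - (p - q) ≡ q
  p-[p-q]≡q = solve 2 (λ p q → p :- (p :- q) := q) refl

  0<q-p : p < q → 0ℚ < q - p
  0<q-p {p} {q} p<q = subst (_< q - p) (ℚ.+-inverseʳ p) (ℚ.+-monoˡ-< (- p) p<q)

  0≤q-p : p ≤ q → 0ℚ ≤ q - p
  0≤q-p {p} {q} p≤q = subst (_≤ q - p) (ℚ.+-inverseʳ p) (ℚ.+-monoˡ-≤ (- p) p≤q)

  0<1 : 0ℚ < 1ℚ
  0<1 = ℚ.positive⁻¹ 1ℚ

  +-pos : 0ℚ < p → 0ℚ < q → 0ℚ < p + q
  +-pos = ℚ.+-mono-<

  *-monoʳ-< : 0ℚ < r → p < q → r * p < r * q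
  *-monoʳ-< {r} 0<r = ℚ.*-monoʳ-<-pos r {{positive 0<r}}

  *-monoˡ-< : 0ℚ < r → p < q → p * r < q * r
  *-monoˡ-< {r} 0<r = ℚ.*-monoˡ-<-pos r {{positive 0<r}}

  *-monoʳ-≤ : 0ℚ ≤ r → p ≤ q → r * p ≤ r * q
  *-monoʳ-≤ {r} 0≤r = ℚ.*-monoˡ-≤-nonNeg r {{nonNegative 0≤r}}

  *-monoˡ-≤ : 0ℚ ≤ r → p ≤ q → p * r ≤ q * r
  *-monoˡ-≤ {r} 0≤r = ℚ.*-monoʳ-≤-nonNeg r {{nonNegative 0≤r}}

  *-pos : 0ℚ < p → 0ℚ < q → 0ℚ < p * q
  *-pos {p} {q} 0<p 0<q = subst (_< p * q) (ℚ.*-zeroʳ p) (*-monoʳ-< 0<p 0<q)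

  *-nonNeg : 0ℚ ≤ p → 0ℚ ≤ q → 0ℚ ≤ p * q
  *-nonNeg {p} {q} 0≤p 0≤q = subst (_≤ p * q) (ℚ.*-zeroʳ p) (*-monoʳ-≤ 0≤p 0≤q)

  *-mono-≤ : 0ℚ ≤ p → 0ℚ ≤ q → p ≤ p′ → q ≤ q′ → p * q ≤ p′ * q′
  *-mono-≤ 0≤p 0≤q p≤p′ q≤q′ =
    ≤-trans (*-monoˡ-≤ 0≤q p≤p′) (*-monoʳ-≤ (≤-trans 0≤p p≤p′) q≤q′)

  abstract
    recip : 0ℚ < p → ∃[ h ] 0ℚ < h × p * h ≡ 1ℚ
    recip {p} 0<p = inverse p {{positive 0<p}}
      where
      inverse : ∀ p .{{_ : ℚ.Positive p}} → ∃[ h ] 0ℚ < h × p * h ≡ 1ℚ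
      inverse p = (1/ p) {{ℚ.pos⇒nonZero p}} , ℚ.positive⁻¹ _ {{ℚ.1/pos⇒pos p}} ,
                  ℚ.*-inverseʳ p {{ℚ.pos⇒nonZero p}}

  square-nonNeg : ∀ p → 0ℚ ≤ p * p
  square-nonNeg p with ℚ.≤-total 0ℚ p
  ... | inj₁ 0≤p = *-nonNeg 0≤p 0≤p
  ... | inj₂ p≤0 = subst (0ℚ ≤_) (solve 1 (λ p → :- p :* :- p := p :* p) refl p)
                     (*-nonNeg (ℚ.neg-antimono-≤ p≤0) (ℚ.neg-antimono-≤ p≤0))

  ι-suc : ∀ n → ι (+ suc n) ≡ 1ℚ + ι (+ n)
  ι-suc n = ℚ.toℚᵘ-injective (begin
    toℚᵘ (ι (+ suc n))                     ≈⟨ ℚ.toℚᵘ-fromℚᵘ (ℚᵘ.mkℚᵘ (+ suc n) 0) ⟩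
    ℚᵘ.mkℚᵘ (+ suc n) 0                    ≈⟨ ℚᵘ.*≡* (cong (ℤ._* + 1) (cong (ℤ._+_ (+ 1)) (sym (ℤ.*-identityʳ (+ n))))) ⟩
    ℚᵘ.1ℚᵘ ℚᵘ.+ ℚᵘ.mkℚᵘ (+ n) 0            ≈⟨ ℚᵘ.+-congʳ ℚᵘ.1ℚᵘ (ℚᵘ.≃-sym (ℚ.toℚᵘ-fromℚᵘ (ℚᵘ.mkℚᵘ (+ n) 0))) ⟩
    toℚᵘ 1ℚ ℚᵘ.+ toℚᵘ (ι (+ n))            ≈⟨ ℚᵘ.≃-sym (ℚ.toℚᵘ-homo-+ 1ℚ (ι (+ n))) ⟩
    toℚᵘ (1ℚ + ι (+ n))                    ∎)
    where open ℚᵘ.≃-Reasoning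

  ι-nonNeg : ∀ n → 0ℚ ≤ ι (+ n)
  ι-nonNeg zero    = ≤-refl
  ι-nonNeg (suc n) = subst (0ℚ ≤_) (sym (ι-suc n)) (ℚ.+-mono-≤ (<⇒≤ 0<1) (ι-nonNeg n))

  1≤ι-suc : ∀ n → 1ℚ ≤ ι (+ suc n)
  1≤ι-suc n = ≤-by (ι (+ n)) (ι-nonNeg n) (ι-suc n)

  0<ι-suc : ∀ n → 0ℚ < ι (+ suc n)
  0<ι-suc n = <-≤-trans 0<1 (1≤ι-suc n)

  archimedean : ∀ q → ∃[ n ] q < ι (+ suc n)
  archimedean q@(mkℚ z d _) = ℤ.∣ z ∣ , ℚ.toℚᵘ-cancel-<
    (ℚᵘ.<-respʳ-≃ (ℚᵘ.≃-sym (ℚ.toℚᵘ-fromℚᵘ (ℚᵘ.mkℚᵘ (+ suc ℤ.∣ z ∣) 0)))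
      (ℚᵘ.*<* (ℤ.≤-<-trans (ℤ.≤-reflexive (ℤ.*-identityʳ z))
        (ℤ.≤-<-trans (z≤∣z∣ z) (ℤ.+<+ (ℕ.m≤m*n (suc ℤ.∣ z ∣) (suc d)))))))
    where
    z≤∣z∣ : ∀ z → z ℤ.≤ + ℤ.∣ z ∣
    z≤∣z∣ (+ n)      = ℤ.≤-refl
    z≤∣z∣ (-[1+ n ]) = ℤ.-≤+

  ^-1 : ∀ p → p ^ 1 ≡ p
  ^-1 = ℚ.*-identityʳ

  ^-pos : 0ℚ < p → ∀ n → 0ℚ < p ^ n
  ^-pos 0<p zero    = 0<1
  ^-pos 0<p (suc n) = *-pos 0<p (^-pos 0<p n)

  ^-nonNeg : 0ℚ ≤ p → ∀ n → 0ℚ ≤ p ^ n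
  ^-nonNeg 0≤p zero    = <⇒≤ 0<1
  ^-nonNeg 0≤p (suc n) = *-nonNeg 0≤p (^-nonNeg 0≤p n)

  ^-mono-≤ : 0ℚ ≤ p → p ≤ q → ∀ n → p ^ n ≤ q ^ n
  ^-mono-≤ 0≤p p≤q zero    = ≤-refl
  ^-mono-≤ 0≤p p≤q (suc n) = *-mono-≤ 0≤p (^-nonNeg 0≤p n) p≤q (^-mono-≤ 0≤p p≤q n)

  ^-≤1 : 0ℚ ≤ p → p ≤ 1ℚ → ∀ n → p ^ n ≤ 1ℚ
  ^-≤1 0≤p p≤1 zero    = ≤-refl
  ^-≤1 0≤p p≤1 (suc n) = *-mono-≤ 0≤p (^-nonNeg 0≤p n) p≤1 (^-≤1 0≤p p≤1 n)

  1≤^ : 1ℚ ≤ p → ∀ n → 1ℚ ≤ p ^ n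
  1≤^ 1≤p zero    = ≤-refl
  1≤^ 1≤p (suc n) = *-mono-≤ (<⇒≤ 0<1) (<⇒≤ 0<1) 1≤p (1≤^ 1≤p n)

  bernoulli : ∀ {δ} → - 1ℚ ≤ δ → ∀ n → 1ℚ + ι (+ n) * δ ≤ (1ℚ + δ) ^ n
  bernoulli {δ} -1≤δ zero    = ≤-reflexive (solve 1 (λ δ → con 1ℚ :+ con 0ℚ :* δ := con 1ℚ) refl δ)
  bernoulli {δ} -1≤δ (suc n) = ≤-trans
    (≤-by (ι (+ n) * (δ * δ)) (*-nonNeg (ι-nonNeg n) (square-nonNeg δ))
      (trans (solve 2 (λ δ ν → (con 1ℚ :+ δ) :* (con 1ℚ :+ ν :* δ)
                 := con 1ℚ :+ (con 1ℚ :+ ν) :* δ :+ ν :* (δ :* δ)) refl δ (ι (+ n)))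
             (cong (λ ν → 1ℚ + ν * δ + ι (+ n) * (δ * δ)) (sym (ι-suc n)))))
    (*-monoʳ-≤ (ℚ.+-monoʳ-≤ 1ℚ -1≤δ) (bernoulli -1≤δ n))

  -- The inequality exp(mδ′) ≤ exp(nδ) in terms of the lower bound 1+x ≤ eˣ and
  -- the upper bound eˣ ≤ 1/(1-x).
  module ExpBounds (m n : ℕ) {M N h δ δ′ : ℚ} (1≤M : 1ℚ ≤ M) (1≤N : 1ℚ ≤ N)
    (bernoulliᴹ : ∀ {x} → - 1ℚ ≤ x → 1ℚ + M * x ≤ (1ℚ + x) ^ m)
    (bernoulliᴺ : ∀ {x} → - 1ℚ ≤ x → 1ℚ + N * x ≤ (1ℚ + x) ^ n)
    (0<h : 0ℚ < h) (Mh≡1 : M * h ≡ 1ℚ)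
    (Mδ′≤Nδ : M * δ′ ≤ N * δ) (δ<1 : δ < 1ℚ) (-1<δ′ : - 1ℚ < δ′) where

    h≤1 : h ≤ 1ℚ
    h≤1 = subst₂ _≤_ (ℚ.*-identityˡ h) Mh≡1 (*-monoˡ-≤ (<⇒≤ 0<h) 1≤M)

    δh≤1 : δ * h ≤ 1ℚ
    δh≤1 = ≤-trans (*-monoˡ-≤ (<⇒≤ 0<h) (<⇒≤ δ<1)) (≤-trans (≤-reflexive (ℚ.*-identityˡ h)) h≤1)

    0≤1+δ′ : 0ℚ ≤ 1ℚ + δ′
    0≤1+δ′ = ℚ.+-monoʳ-≤ 1ℚ (<⇒≤ -1<δ′)

    0≤1-δ : 0ℚ ≤ 1ℚ - δ
    0≤1-δ = 0≤q-p (<⇒≤ δ<1)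

    δ′≤Nδh : δ′ ≤ N * (δ * h)
    δ′≤Nδh = subst₂ _≤_
      (trans (solve 3 (λ M δ′ h → M :* δ′ :* h := (M :* h) :* δ′) refl M δ′ h)
             (trans (cong (_* δ′) Mh≡1) (ℚ.*-identityˡ δ′)))
      (ℚ.*-assoc N δ h)
      (*-monoˡ-≤ (<⇒≤ 0<h) Mδ′≤Nδ)

    -1≤-lemma : ∀ θ → δ′ ≤ N * θ → - 1ℚ ≤ θ
    -1≤-lemma θ δ′≤Nθ = ≮⇒≥ λ θ<-1 →
      <-irrefl refl (<-trans (<-≤-trans -1<δ′ (≤-trans δ′≤Nθ (Nθ≤θ θ<-1))) θ<-1)
      where
      Nθ≤θ : θ < - 1ℚ → N * θ ≤ θ
      Nθ≤θ θ<-1 = ≤-by ((N - 1ℚ) * (- θ))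
        (*-nonNeg (0≤q-p 1≤N) (≤-trans (<⇒≤ 0<1) (<⇒≤ (ℚ.neg-antimono-< θ<-1))))
        (solve 2 (λ N θ → θ := N :* θ :+ (N :- con 1ℚ) :* (:- θ)) refl N θ)

    -1≤δh : - 1ℚ ≤ δ * h
    -1≤δh = -1≤-lemma (δ * h) δ′≤Nδh

    1-δ≡ : 1ℚ - δ ≡ 1ℚ + M * (- (δ * h))
    1-δ≡ = cong (λ x → 1ℚ + x)
      (trans (cong -_ (trans (sym (ℚ.*-identityˡ δ)) (cong (_* δ) (sym Mh≡1))))
             (solve 3 (λ M δ h → :- ((M :* h) :* δ) := M :* (:- (δ :* h))) refl M δ h))

    product≡ : ∀ θ → ((1ℚ + θ) ^ n) ^ m * ((1ℚ - θ) ^ m) ^ n ≡ ((1ℚ + θ) * (1ℚ - θ)) ^ (n ℕ.* m)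
    product≡ θ = trans
      (cong₂ _*_ (^-assocʳ (1ℚ + θ) n m)
        (trans (^-assocʳ (1ℚ - θ) m n) (cong ((1ℚ - θ) ^_) (ℕ.*-comm m n))))
      (sym (^-distrib-* (1ℚ + θ) (1ℚ - θ) (n ℕ.* m)))

    1-θ²≤1 : ∀ θ → (1ℚ + θ) * (1ℚ - θ) ≤ 1ℚ
    1-θ²≤1 θ = ≤-by (θ * θ) (square-nonNeg θ)
      (solve 1 (λ θ → con 1ℚ := (con 1ℚ :+ θ) :* (con 1ℚ :- θ) :+ θ :* θ) refl θ)

    result : (1ℚ + δ′) ^ m * (1ℚ - δ) ^ n ≤ 1ℚ
    result =
      ≤-trans (*-mono-≤ (^-nonNeg 0≤1+δ′ m) (^-nonNeg 0≤1-δ n)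
                (^-mono-≤ 0≤1+δ′ (≤-trans (ℚ.+-monoʳ-≤ 1ℚ δ′≤Nδh) (bernoulliᴺ -1≤δh)) m)
                (^-mono-≤ 0≤1-δ (≤-trans (≤-reflexive 1-δ≡) (bernoulliᴹ (ℚ.neg-antimono-≤ δh≤1))) n))
      (subst (_≤ 1ℚ) (sym (product≡ (δ * h)))
        (^-≤1 (*-nonNeg (ℚ.+-monoʳ-≤ 1ℚ -1≤δh) (0≤q-p δh≤1)) (1-θ²≤1 (δ * h)) (n ℕ.* m)))

  exp-bounds : ∀ m n {δ δ′} → ι (+ suc m) * δ′ ≤ ι (+ suc n) * δ → δ < 1ℚ → - 1ℚ < δ′ →
               (1ℚ + δ′) ^ suc m * (1ℚ - δ) ^ suc n ≤ 1ℚ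
  exp-bounds m n =
    let _ , 0<h , Mh≡1 = recip (0<ι-suc m) in
    ExpBounds.result (suc m) (suc n) (1≤ι-suc m) (1≤ι-suc n)
      (λ -1≤x → bernoulli -1≤x (suc m)) (λ -1≤x → bernoulli -1≤x (suc n)) 0<h Mh≡1

open ℚ-Lemmas

record ℝ : Set₁ where
  field
    lower upper     : ℚ → Set
    lower-inhabited : ∃ lower
    upper-inhabited : ∃ upper
    lower-closed    : q < r → lower r → lower q
    upper-closed    : q < r → upper q → upper r
    lower-open      : lower q → ∃[ r ] q < r × lower r
    upper-open      : upper r → ∃[ q ] q < r × upper q
    disjoint        : lower q → upper r → q < r
    located         : q < r → lower q ⊎ upper r

open ℝ

infix 4 _<ℝ_ _≤ℝ_

_<ℝ_ : ℝ → ℝ → Set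
x <ℝ y = ∃[ q ] upper x q × lower y q

_≤ℝ_ : ℝ → ℝ → Set
x ≤ℝ y = ¬ (y <ℝ x)

fromℚ : ℚ → ℝ
fromℚ p = record
  { lower           = _< p
  ; upper           = p <_
  ; lower-inhabited = p - 1ℚ , <-by 1ℚ 0<1 (sym (q-p+p≡q p 1ℚ))
  ; upper-inhabited = p + 1ℚ , <-by 1ℚ 0<1 refl
  ; lower-closed    = <-trans
  ; upper-closed    = λ q<r p<q → <-trans p<q q<r
  ; lower-open      = λ q<p → let r , q<r , r<p = <-dense q<p in r , q<r , r<p
  ; upper-open      = λ p<r → let q , p<q , q<r = <-dense p<r in q , q<r , p<q
  ; disjoint        = <-trans
  ; located         = loc
  }
  where
  loc : q < r → q < p ⊎ p < r
  loc {q} q<r with q ℚ.<? p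
  ... | yes q<p = inj₁ q<p
  ... | no  q≮p = inj₂ (≤-<-trans (≮⇒≥ q≮p) q<r)

0ℝ 1ℝ : ℝ
0ℝ = fromℚ 0ℚ
1ℝ = fromℚ 1ℚ

<ℝ-trans : ∀ {x y z} → x <ℝ y → y <ℝ z → x <ℝ z
<ℝ-trans {x} {y} (q , x<q , q<y) (r , y<r , r<z) = r , upper-closed x (disjoint y q<y y<r) x<q , r<z

-- A set L of rational lower bounds and a set U of rational upper bounds that
-- come arbitrarily close to each other determine a real number, namely
-- sup L = inf U.
record Bounds : Set₁ where
  field
    L U         : ℚ → Set
    L-inhabited : ∃ L
    U-inhabited : ∃ U
    L≤U         : L q → U r → q ≤ r
    close       : q < r → L q ⊎ U r

cut : Bounds → ℝ
cut B = record
  { lower           = λ q → ∃[ q′ ] q < q′ × L q′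
  ; upper           = λ r → ∃[ r′ ] r′ < r × U r′
  ; lower-inhabited = let q , Lq = L-inhabited in
                      q - 1ℚ , q , <-by 1ℚ 0<1 (sym (q-p+p≡q q 1ℚ)) , Lq
  ; upper-inhabited = let r , Ur = U-inhabited in r + 1ℚ , r , <-by 1ℚ 0<1 refl , Ur
  ; lower-closed    = λ q<r (r′ , r<r′ , Lr′) → r′ , <-trans q<r r<r′ , Lr′
  ; upper-closed    = λ q<r (q′ , q′<q , Uq′) → q′ , <-trans q′<q q<r , Uq′
  ; lower-open      = λ (q′ , q<q′ , Lq′) → let s , q<s , s<q′ = <-dense q<q′ in s , q<s , q′ , s<q′ , Lq′
  ; upper-open      = λ (r′ , r′<r , Ur′) → let s , r′<s , s<r = <-dense r′<r in s , s<r , r′ , r′<s , Ur′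
  ; disjoint        = λ (q′ , q<q′ , Lq′) (r′ , r′<r , Ur′) → <-trans q<q′ (≤-<-trans (L≤U Lq′ Ur′) r′<r)
  ; located         = λ q<r →
      let s , q<s , s<r = <-dense q<r
          t , s<t , t<r = <-dense s<r
      in map (λ Ls → s , q<s , Ls) (λ Ut → t , t<r , Ut) (close s<t)
  }
  where open Bounds B

module Approximation where

  module Walk (x : ℝ) {δ ε : ℚ} (0<δ : 0ℚ < δ) (ε≡δ+δ : ε ≡ δ + δ) where

    q+δ<q+ε : ∀ q → q + δ < q + ε
    q+δ<q+ε q = <-by δ 0<δ (trans (cong (λ z → q + z) ε≡δ+δ) (sym (ℚ.+-assoc q δ δ)))

    step : ∀ q n → q + ι (+ suc n) * δ ≡ (q + δ) + ι (+ n) * δ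
    step q n = trans (cong (λ ν → q + ν * δ) (ι-suc n)) (shift (ι (+ n)))
      where
      shift : ∀ ν → q + (1ℚ + ν) * δ ≡ (q + δ) + ν * δ
      shift ν = solve 3 (λ q ν δ → q :+ (con 1ℚ :+ ν) :* δ := (q :+ δ) :+ ν :* δ) refl q ν δ

    walk : ∀ {s} n q → s ≤ q → lower x q → upper x (q + ι (+ n) * δ) →
           ∃[ q ] s ≤ q × lower x q × upper x (q + ε)
    walk zero q _ Lq Uq = ⊥-elim (<-irrefl
      (sym (trans (cong (λ z → q + z) (ℚ.*-zeroˡ δ)) (ℚ.+-identityʳ q))) (disjoint x Lq Uq))
    walk (suc n) q s≤q Lq Uq with located x (q+δ<q+ε q)
    ... | inj₂ Uq+ε = q , s≤q , Lq , Uq+ε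
    ... | inj₁ Lq+δ = walk n (q + δ) (≤-trans s≤q (≤-by δ (<⇒≤ 0<δ) refl)) Lq+δ
                        (subst (upper x) (step q n) Uq)

    reach : ∀ {u s h N} → δ * h ≡ 1ℚ → (u - s) * h < N → u < s + N * δ
    reach {u} {s} {h} {N} δh≡1 lt = subst (_< s + N * δ)
      (trans (cong (λ z → s + z)
               (trans (solve 4 (λ u s h δ → (u :- s) :* h :* δ := (u :- s) :* (δ :* h)) refl u s h δ)
                      (trans (cong ((u - s) *_) δh≡1) (ℚ.*-identityʳ (u - s)))))
             (sym (p≡q+[p-q] u s)))
      (ℚ.+-monoʳ-< s (*-monoˡ-< 0<δ lt))

  0<½* : 0ℚ < p → 0ℚ < p * ½
  0<½* 0<p = *-pos 0<p (ℚ.positive⁻¹ ½)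

  halves : ∀ p → p ≡ p * ½ + p * ½
  halves = solve 1 (λ p → p := p :* con ½ :+ p :* con ½) refl

  abstract
    approximate : ∀ {s ε} x → lower x s → 0ℚ < ε → ∃[ q ] s ≤ q × lower x q × upper x (q + ε)
    approximate {s} {ε} x Ls 0<ε =
      let u , Uu         = upper-inhabited x
          h , _ , δh≡1   = recip (0<½* 0<ε)
          n , [u-s]h<1+n = archimedean ((u - s) * h)
      in walk (suc n) s ≤-refl Ls (upper-closed x (reach δh≡1 [u-s]h<1+n) Uu)
      where open Walk x (0<½* 0<ε) (halves ε)

open Approximation

record ℝ⁺ : Set₁ where
  constructor pos
  field
    real   : ℝ
    0<real : 0ℝ <ℝ real

open ℝ⁺ public

infix 8 _⁻¹
infixl 7 _*ℝ_ _/ℝ_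

_*ℝ_ : ℝ⁺ → ℝ⁺ → ℝ⁺
pos x (l , 0<l , Ll) *ℝ pos y (m , 0<m , Lm) = pos (cut bounds)
  (l * m * ½ , 0<½* 0<lm , l * m , <-by (l * m * ½) (0<½* 0<lm) (halves (l * m)) , L-lm)
  where
  open Bounds

  0<lm : 0ℚ < l * m
  0<lm = *-pos 0<l 0<m

  L* U* : ℚ → Set
  L* q = ∃[ s ] ∃[ t ] 0ℚ < s × 0ℚ < t × lower x s × lower y t × q ≤ s * t
  U* r = ∃[ s ] ∃[ t ] upper x s × upper y t × s * t ≤ r

  L-lm : L* (l * m)
  L-lm = l , m , 0<l , 0<m , Ll , Lm , ≤-refl

  module Close {q r u v h ε : ℚ} (q<r : q < r)
    (Uu : upper x u) (Uv : upper y v) (0<uv : 0ℚ < u + v)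
    (0<h : 0ℚ < h) (Dh≡1 : (u + v + 1ℚ + (r - q)) * h ≡ 1ℚ) (ε≡ : ε ≡ (r - q) * h) where

    0<ε : 0ℚ < ε
    0<ε = subst (0ℚ <_) (sym ε≡) (*-pos (0<q-p q<r) 0<h)

    gap≤D : r - q ≤ u + v + 1ℚ + (r - q)
    gap≤D = ≤-by (u + v + 1ℚ) (<⇒≤ (+-pos 0<uv 0<1)) (ℚ.+-comm (u + v + 1ℚ) (r - q))

    u+v+1≤D : u + v + 1ℚ ≤ u + v + 1ℚ + (r - q)
    u+v+1≤D = ≤-by (r - q) (<⇒≤ (0<q-p q<r)) refl

    ε≤1 : ε ≤ 1ℚ
    ε≤1 = subst₂ _≤_ (sym ε≡) Dh≡1 (*-monoˡ-≤ (<⇒≤ 0<h) gap≤D)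

    [u+v+1]ε≤r-q : (u + v + 1ℚ) * ε ≤ r - q
    [u+v+1]ε≤r-q = ≤-trans (*-monoˡ-≤ (<⇒≤ 0<ε) u+v+1≤D)
      (≤-reflexive (trans (cong ((u + v + 1ℚ + (r - q)) *_) ε≡)
        (trans (solve 3 (λ D d h → D :* (d :* h) := d :* (D :* h)) refl (u + v + 1ℚ + (r - q)) (r - q) h)
               (trans (cong ((r - q) *_) Dh≡1) (ℚ.*-identityʳ (r - q))))))

    bound : ∀ {s t} → s < u → t < v → s * t ≤ q → (s + ε) * (t + ε) ≤ r
    bound {s} {t} s<u t<v st≤q = ≤-trans
      (≤-reflexive (solve 3 (λ s t ε → (s :+ ε) :* (t :+ ε) := s :* t :+ (s :+ t :+ ε) :* ε) refl s t ε))
      (≤-trans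
        (ℚ.+-mono-≤ st≤q (≤-trans
          (*-monoˡ-≤ (<⇒≤ 0<ε) (ℚ.+-mono-≤ (ℚ.+-mono-≤ (<⇒≤ s<u) (<⇒≤ t<v)) ε≤1))
          [u+v+1]ε≤r-q))
        (≤-reflexive (sym (p≡q+[p-q] r q))))

    decide : ∀ {s t} → l ≤ s → m ≤ t → lower x s → lower y t → upper x (s + ε) → upper y (t + ε) →
             q ≤ s * t ⊎ s * t ≤ q → L* q ⊎ U* r
    decide {s} {t} l≤s m≤t Ls Lt Us+ε Ut+ε = map
      (λ q≤st → s , t , <-≤-trans 0<l l≤s , <-≤-trans 0<m m≤t , Ls , Lt , q≤st)
      (λ st≤q → s + ε , t + ε , Us+ε , Ut+ε , bound (disjoint x Ls Uu) (disjoint y Lt Uv) st≤q)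

    result : L* q ⊎ U* r
    result =
      let s , l≤s , Ls , Us+ε = approximate x Ll 0<ε
          t , m≤t , Lt , Ut+ε = approximate y Lm 0<ε
      in decide l≤s m≤t Ls Lt Us+ε Ut+ε (ℚ.≤-total q (s * t))

  close* : q < r → L* q ⊎ U* r
  close* q<r =
    let u , Uu = upper-inhabited x
        v , Uv = upper-inhabited y
        0<uv   = +-pos (<-trans 0<l (disjoint x Ll Uu)) (<-trans 0<m (disjoint y Lm Uv))
        h , 0<h , Dh≡1 = recip (+-pos (+-pos 0<uv 0<1) (0<q-p q<r))
    in Close.result q<r Uu Uv 0<uv 0<h Dh≡1 refl

  bounds : Bounds
  bounds .L = L*
  bounds .U = U*
  bounds .L-inhabited = _ , L-lm
  bounds .U-inhabited =
    let u , Uu = upper-inhabited x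
        v , Uv = upper-inhabited y
    in u * v , u , v , Uu , Uv , ≤-refl
  bounds .L≤U (s , t , 0<s , 0<t , Ls , Lt , q≤st) (s′ , t′ , Us′ , Ut′ , s′t′≤r) =
    ≤-trans q≤st (≤-trans (*-mono-≤ (<⇒≤ 0<s) (<⇒≤ 0<t) (<⇒≤ (disjoint x Ls Us′)) (<⇒≤ (disjoint y Lt Ut′)))
                          s′t′≤r)
  bounds .close = close*

_⁻¹ : ℝ⁺ → ℝ⁺
pos y (m , 0<m , Lm) ⁻¹ = pos (cut bounds) 0<y⁻¹
  where
  open Bounds

  L⁻ U⁻ : ℚ → Set
  L⁻ q = ∃[ u ] upper y u × q * u ≤ 1ℚ
  U⁻ r = ∃[ l ] 0ℚ < l × lower y l × 1ℚ ≤ r * l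

  L-recip : ∃[ q ] 0ℚ < q × L⁻ q
  L-recip =
    let u , Uu = upper-inhabited y
        h , 0<h , uh≡1 = recip (<-trans 0<m (disjoint y Lm Uu))
    in h , 0<h , u , Uu , ≤-reflexive (trans (ℚ.*-comm h u) uh≡1)

  L≤U⁻ : L⁻ q → U⁻ r → q ≤ r
  L≤U⁻ {q} {r} (u , Uu , qu≤1) (l , 0<l , Ll , 1≤rl) with q ℚ.≤? 0ℚ
  ... | yes q≤0 = ≤-trans q≤0 (ℚ.*-cancelʳ-≤-pos l {{positive 0<l}}
                    (≤-trans (≤-reflexive (ℚ.*-zeroˡ l)) (≤-trans (<⇒≤ 0<1) 1≤rl)))
  ... | no  q≰0 = ℚ.*-cancelʳ-≤-pos l {{positive 0<l}}
                    (≤-trans (*-monoʳ-≤ (<⇒≤ (≰⇒> q≰0)) (<⇒≤ (disjoint y Ll Uu))) (≤-trans qu≤1 1≤rl))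

  close⁻ : q < r → L⁻ q ⊎ U⁻ r
  close⁻ {q} {r} q<r with q ℚ.≤? 0ℚ
  ... | yes q≤0 =
        let u , Uu = upper-inhabited y in
        inj₁ (u , Uu , ≤-trans (*-monoˡ-≤ (<⇒≤ (<-trans 0<m (disjoint y Lm Uu))) q≤0)
                               (≤-trans (≤-reflexive (ℚ.*-zeroˡ u)) (<⇒≤ 0<1)))
  ... | no  q≰0 =
        let 0<q = ≰⇒> q≰0
            g , 0<g , qg≡1 = recip 0<q
            h , 0<h , rh≡1 = recip (<-trans 0<q q<r)
            h<g = ℚ.*-cancelˡ-<-nonNeg q {{nonNegative (<⇒≤ 0<q)}}
                    (subst (q * h <_) (trans rh≡1 (sym qg≡1)) (*-monoˡ-< 0<h q<r))
        in swap (map (λ Lh → h , 0<h , Lh , ≤-reflexive (sym rh≡1))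
                     (λ Ug → g , Ug , ≤-reflexive qg≡1)
                     (located y h<g))

  bounds : Bounds
  bounds .L = L⁻
  bounds .U = U⁻
  bounds .L-inhabited = let h , _ , Lh = L-recip in h , Lh
  bounds .U-inhabited = let h , 0<h , mh≡1 = recip 0<m in
                        h , m , 0<m , Lm , ≤-reflexive (sym (trans (ℚ.*-comm h m) mh≡1))
  bounds .L≤U = L≤U⁻
  bounds .close = close⁻

  0<y⁻¹ : 0ℝ <ℝ cut bounds
  0<y⁻¹ = let h , 0<h , Lh = L-recip
              q , 0<q , q<h = <-dense 0<h
          in q , 0<q , h , q<h , Lh

_/ℝ_ : ℝ⁺ → ℝ⁺ → ℝ⁺
x /ℝ y = x *ℝ y ⁻¹

-- The natural logarithm, from
--   e^(nδ) = inf { (1-δ)⁻ⁿ } and e^(nδ) = sup { (1+δ)ⁿ } over n ≥ 1 with nδ fixed: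
-- nδ is a lower bound of log x if (1-δ)⁻ⁿ ≤ x, and an upper bound if x ≤ (1+δ)ⁿ.
module Log (x : ℝ) where

  L U : ℚ → Set
  L q = ∃[ n ] ∃[ δ ] q ≤ ι (+ suc n) * δ × δ < 1ℚ ×
          ∃[ s ] lower x s × 1ℚ ≤ s * (1ℚ - δ) ^ suc n
  U r = ∃[ n ] ∃[ δ ] ι (+ suc n) * δ ≤ r × - 1ℚ < δ ×
          ∃[ u ] upper x u × u ≤ (1ℚ + δ) ^ suc n

  L-recip : ∀ {s} → 0ℚ < s → lower x s → s * p ≡ 1ℚ → 0ℚ < p → L (1ℚ - p)
  L-recip {p = p} {s = s} 0<s Ls sp≡1 0<p =
    0 , 1ℚ - p , ≤-reflexive (sym (ℚ.*-identityˡ (1ℚ - p))) ,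
    <-by p 0<p (sym (q-p+p≡q 1ℚ p)) , s , Ls ,
    ≤-reflexive (sym (trans (cong (s *_) (trans (^-1 _) (p-[p-q]≡q 1ℚ p))) sp≡1))

  U-pred : ∀ {u} → 0ℚ < u → upper x u → U (u - 1ℚ)
  U-pred {u} 0<u Uu =
    0 , u - 1ℚ , ≤-reflexive (ℚ.*-identityˡ (u - 1ℚ)) ,
    <-by u 0<u (ℚ.+-comm u (- 1ℚ)) , u , Uu ,
    ≤-reflexive (trans (p≡q+[p-q] u 1ℚ) (sym (^-1 _)))

  L≤U : L q → U r → q ≤ r
  L≤U {q} {r} (n , δ , q≤nδ , δ<1 , s , Ls , 1≤s[1-δ]ⁿ) (m , δ′ , mδ′≤r , -1<δ′ , u , Uu , u≤[1+δ′]ᵐ)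
    with q ℚ.≤? r
  ... | yes q≤r = q≤r
  ... | no  q≰r = ⊥-elim (<-irrefl refl (≤-<-trans 1≤s[1-δ]ⁿ
        (<-≤-trans (*-monoˡ-< 0<[1-δ]ⁿ (disjoint x Ls Uu))
        (≤-trans (*-monoˡ-≤ (<⇒≤ 0<[1-δ]ⁿ) u≤[1+δ′]ᵐ)
                 (exp-bounds m n (≤-trans mδ′≤r (≤-trans (<⇒≤ (≰⇒> q≰r)) q≤nδ)) δ<1 -1<δ′)))))
    where
    0<[1-δ]ⁿ = ^-pos (0<q-p δ<1) (suc n)

  module Close {q r g h N : ℚ} (n : ℕ)
    (0<g : 0ℚ < g) ([r-q]g≡1 : (r - q) * g ≡ 1ℚ) (0<r-q : 0ℚ < r - q)
    (q<N : q < N) (-r<N : - r < N) (qrg<N : q * r * g < N)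
    (0<h : 0ℚ < h) (Nh≡1 : N * h ≡ 1ℚ) where

    N* : ∀ p → N * (p * h) ≡ p
    N* p = trans (solve 3 (λ N p h → N :* (p :* h) := (N :* h) :* p) refl N p h)
                 (trans (cong (_* p) Nh≡1) (ℚ.*-identityˡ p))

    qh<1 : q * h < 1ℚ
    qh<1 = subst (q * h <_) Nh≡1 (*-monoˡ-< 0<h q<N)

    -1<rh : - 1ℚ < r * h
    -1<rh = subst (- 1ℚ <_) (solve 2 (λ r h → :- (:- r :* h) := r :* h) refl r h)
              (ℚ.neg-antimono-< (subst (- r * h <_) Nh≡1 (*-monoˡ-< 0<h -r<N)))

    qr<[r-q]N : q * r < (r - q) * N
    qr<[r-q]N = subst (_< (r - q) * N)
      (trans (solve 3 (λ d p g → d :* (p :* g) := p :* (d :* g)) refl (r - q) (q * r) g)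
             (trans (cong (q * r *_) [r-q]g≡1) (ℚ.*-identityʳ (q * r))))
      (*-monoʳ-< 0<r-q qrg<N)

    base≡ : (1ℚ + r * h) * (1ℚ - q * h) ≡ 1ℚ + ((r - q) * N - q * r) * (h * h)
    base≡ = trans (trans
      (solve 3 (λ q r h → (con 1ℚ :+ r :* h) :* (con 1ℚ :- q :* h)
          := con 1ℚ :+ ((r :- q) :* con 1ℚ :* h :- q :* r :* (h :* h))) refl q r h)
      (cong (λ z → 1ℚ + ((r - q) * z * h - q * r * (h * h))) (sym Nh≡1)))
      (solve 4 (λ d N c h → con 1ℚ :+ (d :* (N :* h) :* h :- c :* (h :* h))
          := con 1ℚ :+ (d :* N :- c) :* (h :* h)) refl (r - q) N (q * r) h)

    1<base : 1ℚ < (1ℚ + r * h) * (1ℚ - q * h)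
    1<base = <-by (((r - q) * N - q * r) * (h * h))
      (*-pos (0<q-p qr<[r-q]N) (*-pos 0<h 0<h)) base≡

    0<P : 0ℚ < (1ℚ - q * h) ^ suc n
    0<P = ^-pos (0<q-p qh<1) (suc n)

    1<^suc : ∀ {b} → 1ℚ < b → 1ℚ < b ^ suc n
    1<^suc {b} 1<b = <-≤-trans 1<b (subst (_≤ b ^ suc n) (ℚ.*-identityʳ b)
      (*-monoʳ-≤ (≤-trans (<⇒≤ 0<1) (<⇒≤ 1<b)) (1≤^ (<⇒≤ 1<b) n)))

    1<QP : 1ℚ < (1ℚ + r * h) ^ suc n * (1ℚ - q * h) ^ suc n
    1<QP = subst (1ℚ <_) (^-distrib-* (1ℚ + r * h) (1ℚ - q * h) (suc n)) (1<^suc 1<base)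

    1/P<Q : ∀ {s} P Q → 0ℚ < P → P * s ≡ 1ℚ → 1ℚ < Q * P → s < Q
    1/P<Q {s} P Q 0<P Ps≡1 1<QP = ℚ.*-cancelʳ-<-nonNeg P {{nonNegative (<⇒≤ 0<P)}}
      (subst (_< Q * P) (sym (trans (ℚ.*-comm s P) Ps≡1)) 1<QP)

    result : N ≡ ι (+ suc n) → L q ⊎ U r
    result refl =
      let s , _ , Ps≡1 = recip 0<P in
      map (λ Ls → n , q * h , ≤-reflexive (sym (N* q)) , qh<1 , s , Ls ,
                  ≤-reflexive (sym (trans (ℚ.*-comm s _) Ps≡1)))
          (λ UQ → n , r * h , ≤-reflexive (N* r) , -1<rh , _ , UQ , ≤-refl)
          (located x (1/P<Q _ _ 0<P Ps≡1 1<QP))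

  close : q < r → L q ⊎ U r
  close {q} {r} q<r =
    let g , 0<g , dg≡1 = recip (0<q-p q<r)
        n , B<N        = archimedean (q ℚ.⊔ (- r) ℚ.⊔ (q * r * g))
        h , 0<h , Nh≡1 = recip (0<ι-suc n)
    in Close.result n 0<g dg≡1 (0<q-p q<r)
         (≤-<-trans (≤-trans (ℚ.p≤p⊔q q (- r)) (ℚ.p≤p⊔q _ (q * r * g))) B<N)
         (≤-<-trans (≤-trans (ℚ.p≤q⊔p q (- r)) (ℚ.p≤p⊔q _ (q * r * g))) B<N)
         (≤-<-trans (ℚ.p≤q⊔p (q ℚ.⊔ (- r)) (q * r * g)) B<N)
         0<h Nh≡1 refl

  bounds : 0ℝ <ℝ x → Bounds
  bounds (l , 0<l , Ll) = record
    { L = L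
    ; U = U
    ; L-inhabited = let p , 0<p , lp≡1 = recip 0<l in 1ℚ - p , L-recip 0<l Ll lp≡1 0<p
    ; U-inhabited =
        let u , Uu = upper-inhabited x
            0<u = <-trans 0<l (disjoint x Ll Uu)
        in u - 1ℚ , U-pred 0<u Uu
    ; L≤U = L≤U
    ; close = close
    }

  log-positive : (0<x : 0ℝ <ℝ x) → 1ℝ <ℝ x → 0ℝ <ℝ cut (bounds 0<x)
  log-positive _ (s , 1<s , Ls) =
    let 0<s = <-trans 0<1 1<s
        p , 0<p , sp≡1 = recip 0<s
        p<1 = subst₂ _<_ (ℚ.*-identityˡ p) sp≡1 (*-monoˡ-< 0<p 1<s)
        q , 0<q , q<1-p = <-dense (0<q-p p<1)
    in q , 0<q , 1ℚ - p , q<1-p , L-recip 0<s Ls sp≡1 0<p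

log : ℝ⁺ → ℝ
log (pos x 0<x) = cut (Log.bounds x 0<x)

log⁺ : (x : ℝ⁺) → 1ℝ <ℝ real x → ℝ⁺
log⁺ x 1<x = pos (log x) (Log.log-positive (real x) (0<real x) 1<x)

1<* : ∀ x y → 1ℝ <ℝ real x → 1ℝ <ℝ real y → 1ℝ <ℝ real (x *ℝ y)
1<* x y (s , 1<s , Ls) (t , 1<t , Lt) =
  s , 1<s , s * t , subst (_< s * t) (ℚ.*-identityʳ s) (*-monoʳ-< 0<s 1<t) ,
  s , t , 0<s , <-trans 0<1 1<t , Ls , Lt , ≤-refl
  where 0<s = <-trans 0<1 1<s

infix 4 ⌈_⌉≡_

-- ⌈ x ⌉≡ k says that k is the least integer that is at least x; such a k cannot
-- be computed from an arbitrary cut.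
⌈_⌉≡_ : ℝ → ℤ → Set
⌈ x ⌉≡ k = x ≤ℝ fromℚ (ι k) × (∀ j → x ≤ℝ fromℚ (ι j) → k ℤ.≤ j)

infix 4 _∈⟨_,_⟩

_∈⟨_,_⟩ : ℚ → ℝ → ℝ → Set
p ∈⟨ x , y ⟩ = x <ℝ fromℚ p × fromℚ p <ℝ y

-- The greatest e ≤ k with pᵉ ∣ n.
maxExponent : ℕ → ℕ → ℕ → ℕ
maxExponent p n zero    = 0
maxExponent p n (suc k) with (p ℕ.^ suc k) ∣? n
... | yes _ = suc k
... | no  _ = maxExponent p n k

-- For p ≥ 2 and n ≥ 1, pᵉ ∣ n forces e < pᵉ ≤ n, so the search bound n is harmless.
-- The added top element plays the role of ∞.
v : ℕ → ℤ → ℕ ⁺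
v p x with ℤ.∣ x ∣
... | zero  = ⊤⁺
... | suc n = [ maxExponent p (suc n) (suc n) ]

infixl 6 _⊔⁺_

_⊔⁺_ : ℕ ⁺ → ℕ ⁺ → ℕ ⁺
[ k ] ⊔⁺ [ l ] = [ k ℕ.⊔ l ]
[ _ ] ⊔⁺ ⊤⁺    = ⊤⁺
⊤⁺    ⊔⁺ _     = ⊤⁺

record Graph : Set₁ where
  field
    Vertex      : Set
    Adj         : Vertex → Vertex → Set
    symmetric   : ∀ {u w} → Adj u w → Adj w u
    irreflexive : ∀ {u} → ¬ Adj u u

open Graph

infix 4 χ_≤_ χ_≡_

Colourable : Graph → ℕ → Set
Colourable G k = Σ (Vertex G → Fin k) λ f → ∀ {u w} → Adj G u w → f u ≢ f w

-- The chromatic number is the least number of colours of a proper colouring;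
-- it is only ever compared with a natural number.
χ_≤_ : Graph → ℕ → Set
χ G ≤ k = ∃[ j ] j ℕ.≤ k × Colourable G j

χ_≡_ : Graph → ℕ → Set
χ G ≡ k = Colourable G k × (∀ j → Colourable G j → k ℕ.≤ j)

record ℕ₊ : Set where
  constructor mk
  field
    value         : ℕ
    .{{nonZero}}  : ℕ.NonZero value

ratio : ℕ₊ → ℕ₊ → ℚ
ratio (mk m) (mk n) = + m / n

ratio-self : ∀ n → ratio n n ≡ 1ℚ
ratio-self (mk (suc n)) = ℚ.fromℚᵘ-cong {ℚᵘ.mkℚᵘ (+ suc n) n} {ℚᵘ.1ℚᵘ}
  (ℚᵘ.*≡* (ℤ.*-comm (+ suc n) (+ 1)))

-- A subset of the positive rationals without 1. It may be empty, in which case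
-- the graph below has no edges.
record RatioSet : Set₁ where
  field
    member     : Pred ℚ 0ℓ
    member-pos : member r → 0ℚ < r
    1∉member   : ¬ member 1ℚ

open RatioSet public

G[_] : RatioSet → Graph
G[ R ] = record
  { Vertex      = ℕ₊
  ; Adj         = λ m n → member R (ratio m n) ⊎ member R (ratio n m)
  ; symmetric   = swap
  ; irreflexive = λ {n} → λ where
      (inj₁ e) → 1∉member R (subst (member R) (ratio-self n) e)
      (inj₂ e) → 1∉member R (subst (member R) (ratio-self n) e)
  }

R : ℕ → ℤ → ℕ → ℤ → RatioSet
R a b c d = record
  { member     = λ r → (∃[ n ] r IsValueAt n) × 0ℚ < r × r ≢ 1ℚ
  ; member-pos = λ (_ , 0<r , _) → 0<r
  ; 1∉member   = λ (_ , _ , 1≢1) → 1≢1 refl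
  }
  where
  -- No value at n if cn + d = 0.
  _IsValueAt_ : ℚ → ℕ₊ → Set
  r IsValueAt mk n = Σ (ℚ.NonZero (ι (+ c ℤ.* + n ℤ.+ d))) λ cn+d≢0 →
    r ≡ (ι (+ a ℤ.* + n ℤ.+ b) ÷ ι (+ c ℤ.* + n ℤ.+ d)) {{cn+d≢0}}

G : ℕ → ℤ → ℕ → ℤ → Graph
G a b c d = G[ R a b c d ]

module Submission where

open import Defs
open ℚ-Lemmas
open Approximation using (approximate)
open ℝ using (lower; upper; located; disjoint; lower-open)

open import Algebra.Bundles using (CommutativeRing)
open import Data.Empty using (⊥-elim)
open import Data.Fin.Base using (Fin; zero; toℕ; fromℕ<; combine)
open import Data.Fin.Properties using (toℕ-fromℕ<; combine-injective)
open import Data.Integer.Base as ℤ using (ℤ; +_; -[1+_]; ∣_∣; _-_)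
open import Data.Integer.Divisibility.Signed as ℤ∣ using (divides) renaming (_∣_ to _∣ᶻ_)
import Data.Integer.Properties as ℤ
open import Data.Integer.Tactic.RingSolver using () renaming (solve-∀ to solveᶻ-∀)
open import Data.Nat.Base as ℕ using (ℕ; zero; suc; NonZero; z≤n; s≤s; _*_; _^_; _∸_)
open import Data.Nat.Divisibility using (_∣_; _∣?_; 1∣_; ∣⇒≤; ∣-refl; m%n≡0⇒n∣m)
open import Data.Nat.DivMod using (_/_; _%_; _mod_; m≡m%n+[m/n]*n; m%n<n; n/n≡1; +-distrib-/-∣ˡ)
open import Data.Nat.Primality using (Prime; prime⇒nonZero; prime⇒nonTrivial; euclidsLemma)
import Data.Nat.Properties as ℕ
open import Data.Product using (∃-syntax; _×_; _,_; proj₁; proj₂)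
open import Data.Rational as ℚ using (ℚ; 0ℚ; 1ℚ; toℚᵘ; 1/_; _÷_)
import Data.Rational.Properties as ℚ
open import Data.Rational.Solver using (module +-*-Solver)
import Data.Rational.Unnormalised.Base as ℚᵘ
import Data.Rational.Unnormalised.Properties as ℚᵘ
open import Data.Sum.Base as Sum using (_⊎_; inj₁; inj₂)
open import Relation.Binary.Construct.Add.Supremum.Strict ℕ._<_ using ([<]-injective)
open import Relation.Binary.Definitions using (tri<; tri≈; tri>)
open import Relation.Binary.PropositionalEquality
open import Relation.Nullary.Decidable using (yes; no)
open import Relation.Nullary.Negation using (¬_; contradiction)

open import Algebra.Properties.AbelianGroup ℤ.+-0-abelianGroup using (∙-cancelˡ)
open import Algebra.Properties.CommutativeSemiring.Exp
  (CommutativeRing.commutativeSemiring ℚ.+-*-commutativeRing)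
  using (^-assocʳ; ^-distrib-*; ^-homo-*) renaming (_^_ to infixr 8 _^ℚ_)
open +-*-Solver using (solve; _:+_; _:*_; _:-_; _:=_; con)

-- (i) The members of R and of 1/R above 1 have a rational infimum s, being a
-- finite set together with a monotone sequence, and α ≤ s. The bound k ≥ log αβ / log α
-- gives β ≤ α^(k-1) ≤ s^(k-1), so along an edge ⌊log_s n⌋ changes by at least 1 and
-- by at most k-1, and ⌊log_s n⌋ mod k is a proper colouring. Passing from α to the
-- rational s makes this floor computable.
--
-- (ii), (iii) For m/n = (ax+b)/(ax+d) the valuations of ax+b and ax+d are those of b
-- and d, so v(m) - v(n) = v(b) - v(d). If this is h ≠ 0, then ⌊v(n)/∣h∣⌋ mod 2 is
-- a proper colouring. If it is 0, then the p-free parts m′, n′ of m, n satisfy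
-- (m′-n′)(ax+d) = n′(b-d), so p^(e+1) ∤ m′-n′ for e = v(b-d), and the unit n′ mod p^(e+1) is
-- a proper colouring.

-- Fractions and edge equations

private
  toℚᵘ-ι : ∀ z → toℚᵘ (ι z) ℚᵘ.≃ ℚᵘ.mkℚᵘ z 0
  toℚᵘ-ι z = ℚ.toℚᵘ-fromℚᵘ (ℚᵘ.mkℚᵘ z 0)

ι-+ : ∀ x y → ι (x ℤ.+ y) ≡ ι x ℚ.+ ι y
ι-+ x y = ℚ.toℚᵘ-injective (begin
  toℚᵘ (ι (x ℤ.+ y))                ≈⟨ toℚᵘ-ι (x ℤ.+ y) ⟩
  ℚᵘ.mkℚᵘ (x ℤ.+ y) 0               ≈⟨ ℚᵘ.*≡* (eq x y) ⟩
  ℚᵘ.mkℚᵘ x 0 ℚᵘ.+ ℚᵘ.mkℚᵘ y 0      ≈⟨ ℚᵘ.+-cong (toℚᵘ-ι x) (toℚᵘ-ι y) ⟨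
  toℚᵘ (ι x) ℚᵘ.+ toℚᵘ (ι y)        ≈⟨ ℚ.toℚᵘ-homo-+ (ι x) (ι y) ⟨
  toℚᵘ (ι x ℚ.+ ι y)                ∎)
  where
  open ℚᵘ.≃-Reasoning
  eq : ∀ x y → (x ℤ.+ y) ℤ.* + 1 ≡ (x ℤ.* + 1 ℤ.+ y ℤ.* + 1) ℤ.* + 1
  eq = solveᶻ-∀

ι-* : ∀ x y → ι (x ℤ.* y) ≡ ι x ℚ.* ι y
ι-* x y = ℚ.toℚᵘ-injective (begin
  toℚᵘ (ι (x ℤ.* y))                ≈⟨ toℚᵘ-ι (x ℤ.* y) ⟩
  ℚᵘ.mkℚᵘ x 0 ℚᵘ.* ℚᵘ.mkℚᵘ y 0      ≈⟨ ℚᵘ.*-cong (toℚᵘ-ι x) (toℚᵘ-ι y) ⟨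
  toℚᵘ (ι x) ℚᵘ.* toℚᵘ (ι y)        ≈⟨ ℚ.toℚᵘ-homo-* (ι x) (ι y) ⟨
  toℚᵘ (ι x ℚ.* ι y)                ∎)
  where open ℚᵘ.≃-Reasoning

ι-injective : ∀ {x y} → ι x ≡ ι y → x ≡ y
ι-injective {x} {y} eq with ℚᵘ.≃-trans (ℚᵘ.≃-sym (toℚᵘ-ι x)) (subst (λ z → toℚᵘ z ℚᵘ.≃ ℚᵘ.mkℚᵘ y 0) (sym eq) (toℚᵘ-ι y))
... | ℚᵘ.*≡* x*1≡y*1 = trans (sym (ℤ.*-identityʳ x)) (trans x*1≡y*1 (ℤ.*-identityʳ y))

ι-mono-< : ∀ {x y} → x ℤ.< y → ι x ℚ.< ι y
ι-mono-< {x} {y} x<y = ℚ.toℚᵘ-cancel-< (ℚᵘ.<-respˡ-≃ (ℚᵘ.≃-sym (toℚᵘ-ι x)) (ℚᵘ.<-respʳ-≃ (ℚᵘ.≃-sym (toℚᵘ-ι y))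
  (ℚᵘ.*<* (subst₂ ℤ._<_ (sym (ℤ.*-identityʳ x)) (sym (ℤ.*-identityʳ y)) x<y))))

ratio-* : ∀ m n → ratio m n ℚ.* ι (+ ℕ₊.value n) ≡ ι (+ ℕ₊.value m)
ratio-* (mk m) (mk (suc n)) = ℚ.toℚᵘ-injective (begin
  toℚᵘ ((+ m ℚ./ suc n) ℚ.* ι (+ suc n))           ≈⟨ ℚ.toℚᵘ-homo-* (+ m ℚ./ suc n) (ι (+ suc n)) ⟩
  toℚᵘ (+ m ℚ./ suc n) ℚᵘ.* toℚᵘ (ι (+ suc n))     ≈⟨ ℚᵘ.*-cong (ℚ.toℚᵘ-fromℚᵘ (ℚᵘ.mkℚᵘ (+ m) n)) (toℚᵘ-ι (+ suc n)) ⟩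
  ℚᵘ.mkℚᵘ (+ m) n ℚᵘ.* ℚᵘ.mkℚᵘ (+ suc n) 0         ≈⟨ ℚᵘ.*≡* (eq (+ m) (+ suc n)) ⟩
  ℚᵘ.mkℚᵘ (+ m) 0                                  ≈⟨ toℚᵘ-ι (+ m) ⟨
  toℚᵘ (ι (+ m))                                   ∎)
  where
  open ℚᵘ.≃-Reasoning
  eq : ∀ x y → x ℤ.* y ℤ.* + 1 ≡ x ℤ.* (y ℤ.* + 1)
  eq = solveᶻ-∀

÷-* : ∀ x y .{{_ : ℚ.NonZero y}} → (x ÷ y) ℚ.* y ≡ x
÷-* x y = trans (ℚ.*-assoc x (1/ y) y) (trans (cong (x ℚ.*_) (ℚ.*-inverseˡ y)) (ℚ.*-identityʳ x))

member⇒equation : ∀ {a b c d r} → member (R a b c d) r →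
  ∃[ x ] r ℚ.* ι (+ c ℤ.* + x ℤ.+ d) ≡ ι (+ a ℤ.* + x ℤ.+ b)
member⇒equation {a} {b} {c} {d} ((mk x , nz , refl) , _) = x , ÷-* _ (ι (+ c ℤ.* + x ℤ.+ d)) {{nz}}

-- Clearing denominators in m/n = X/Y gives mY = nX over the integers, the form in which valuations
-- can be compared.
adjacent⇒equation : ∀ {a b c d} m n → member (R a b c d) (ratio m n) →
  ∃[ x ] + ℕ₊.value m ℤ.* (+ c ℤ.* + x ℤ.+ d) ≡ + ℕ₊.value n ℤ.* (+ a ℤ.* + x ℤ.+ b)
adjacent⇒equation {a} {b} {c} {d} m n mem with member⇒equation {a} {b} {c} {d} mem
... | x , eq = x , ι-injective (begin
  ι (M ℤ.* Y)                     ≡⟨ ι-* M Y ⟩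
  ι M ℚ.* ι Y                     ≡⟨ cong (ℚ._* ι Y) (ratio-* m n) ⟨
  ratio m n ℚ.* ι N ℚ.* ι Y       ≡⟨ cong (ℚ._* ι Y) (ℚ.*-comm (ratio m n) (ι N)) ⟩
  ι N ℚ.* ratio m n ℚ.* ι Y       ≡⟨ ℚ.*-assoc (ι N) (ratio m n) (ι Y) ⟩
  ι N ℚ.* (ratio m n ℚ.* ι Y)     ≡⟨ cong (ι N ℚ.*_) eq ⟩
  ι N ℚ.* ι X                     ≡⟨ ι-* N X ⟨
  ι (N ℤ.* X)                     ∎)
  where
  open ≡-Reasoning
  M = + ℕ₊.value m
  N = + ℕ₊.value n
  X = + a ℤ.* + x ℤ.+ b
  Y = + c ℤ.* + x ℤ.+ d

-- Valuations

module Valuation {p : ℕ} (p-prime : Prime p) where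

  private instance
    p≢0 : NonZero p
    p≢0 = prime⇒nonZero p-prime

  1<p : 1 ℕ.< p
  1<p = ℕ.nonTrivial⇒n>1 p {{prime⇒nonTrivial p-prime}}

  -- The valuation as a relation with an explicit cofactor, which can be multiplied and added,
  -- unlike the result of the bounded search `maxExponent`. It excludes z = 0, since p divides 0.
  record Exact (k : ℕ) (z : ℤ) : Set where
    constructor exact
    field
      cofactor   : ℤ
      factorises : z ≡ cofactor ℤ.* + (p ℕ.^ k)
      coprime    : ¬ (+ p) ∣ᶻ cofactor

  euclid : ∀ x y → + p ∣ᶻ x ℤ.* y → + p ∣ᶻ x ⊎ + p ∣ᶻ y
  euclid x y p∣xy = Sum.map ℤ∣.∣ᵤ⇒∣ ℤ∣.∣ᵤ⇒∣
    (euclidsLemma ∣ x ∣ ∣ y ∣ p-prime (subst (p ∣_) (ℤ.∣i*j∣≡∣i∣*∣j∣ x y) (ℤ∣.∣⇒∣ᵤ p∣xy)))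

  pos-^-+ : ∀ i j → + (p ℕ.^ (i ℕ.+ j)) ≡ + (p ℕ.^ i) ℤ.* + (p ℕ.^ j)
  pos-^-+ i j = trans (cong +_ (ℕ.^-distribˡ-+-* p i j)) (ℤ.pos-* (p ℕ.^ i) (p ℕ.^ j))

  exact-* : ∀ {i j x y} → Exact i x → Exact j y → Exact (i ℕ.+ j) (x ℤ.* y)
  exact-* {i} {j} (exact q refl p∤q) (exact r refl p∤r) = exact (q ℤ.* r)
    (trans (interchange q r (+ (p ℕ.^ i)) (+ (p ℕ.^ j))) (cong (q ℤ.* r ℤ.*_) (sym (pos-^-+ i j))))
    (λ p∣qr → Sum.[ p∤q , p∤r ] (euclid q r p∣qr))
    where
    interchange : ∀ q r s t → q ℤ.* s ℤ.* (r ℤ.* t) ≡ q ℤ.* r ℤ.* (s ℤ.* t)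
    interchange = solveᶻ-∀

  -- For k < j, cancelling p^k would leave a factor p in the cofactor.
  ∣⇒≤-exact : ∀ {j k z} → + (p ℕ.^ j) ∣ᶻ z → Exact k z → j ℕ.≤ k
  ∣⇒≤-exact {j} {k} (divides w refl) (exact q eq p∤q) = ℕ.≮⇒≥ λ k<j →
    let l = j ℕ.∸ suc k in
    p∤q (divides (w ℤ.* + (p ℕ.^ l)) (ℤ.*-cancelʳ-≡ q _ (+ (p ℕ.^ k)) {{ℕ.m^n≢0 p k}} (begin
      q ℤ.* + (p ℕ.^ k)                                ≡⟨ eq ⟨
      w ℤ.* + (p ℕ.^ j)                                ≡⟨ cong (λ j → w ℤ.* + (p ℕ.^ j)) (ℕ.m∸n+n≡m k<j) ⟨
      w ℤ.* + (p ℕ.^ (l ℕ.+ suc k))                    ≡⟨ cong (w ℤ.*_) (pos-^-+ l (suc k)) ⟩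
      w ℤ.* (+ (p ℕ.^ l) ℤ.* + (p ℕ.* p ℕ.^ k))        ≡⟨ cong (λ t → w ℤ.* (+ (p ℕ.^ l) ℤ.* t)) (ℤ.pos-* p (p ℕ.^ k)) ⟩
      w ℤ.* (+ (p ℕ.^ l) ℤ.* (+ p ℤ.* + (p ℕ.^ k)))    ≡⟨ assoc w (+ (p ℕ.^ l)) (+ p) (+ (p ℕ.^ k)) ⟩
      w ℤ.* + (p ℕ.^ l) ℤ.* + p ℤ.* + (p ℕ.^ k)        ∎)))
    where
    open ≡-Reasoning
    assoc : ∀ w x y z → w ℤ.* (x ℤ.* (y ℤ.* z)) ≡ w ℤ.* x ℤ.* y ℤ.* z
    assoc = solveᶻ-∀

  exact-unique : ∀ {j k z} → Exact j z → Exact k z → j ≡ k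
  exact-unique x@(exact q eq _) y@(exact r eq′ _) =
    ℕ.≤-antisym (∣⇒≤-exact (divides q eq) y) (∣⇒≤-exact (divides r eq′) x)

  -- The ultrametric property: a multiple of p^(k+1) changes the cofactor of p^k only by a multiple
  -- of p.
  exact-+ : ∀ {k y z} → + (p ℕ.^ suc k) ∣ᶻ y → Exact k z → Exact k (y ℤ.+ z)
  exact-+ {k} (divides w refl) (exact q refl p∤q) = exact (w ℤ.* + p ℤ.+ q)
    (trans (cong (λ t → w ℤ.* t ℤ.+ q ℤ.* + (p ℕ.^ k)) (ℤ.pos-* p (p ℕ.^ k))) (factor w q (+ p) (+ (p ℕ.^ k))))
    (λ p∣wp+q → p∤q (ℤ∣.∣m+n∣m⇒∣n p∣wp+q (divides w refl)))
    where
    factor : ∀ w q p t → w ℤ.* (p ℤ.* t) ℤ.+ q ℤ.* t ≡ (w ℤ.* p ℤ.+ q) ℤ.* t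
    factor = solveᶻ-∀

  n<p^n : ∀ n → n ℕ.< p ℕ.^ n
  n<p^n zero    = s≤s z≤n
  n<p^n (suc n) = ℕ.<-≤-trans (s≤s (n<p^n n))
    (ℕ.≤-trans (ℕ.m<n+m (p ℕ.^ n) (ℕ.m^n>0 p n))
      (subst (ℕ._≤ p ℕ.* p ℕ.^ n) (cong (p ℕ.^ n ℕ.+_) (ℕ.+-identityʳ (p ℕ.^ n))) (ℕ.*-monoˡ-≤ (p ℕ.^ n) 1<p)))

  maxExponent-∣ : ∀ n k → p ℕ.^ maxExponent p n k ∣ n
  maxExponent-∣ n zero = 1∣ n
  maxExponent-∣ n (suc k) with (p ℕ.^ suc k) ∣? n
  ... | yes p^k∣n = p^k∣n
  ... | no  _     = maxExponent-∣ n k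

  maxExponent-max : ∀ n k j → j ℕ.≤ k → p ℕ.^ j ∣ n → j ℕ.≤ maxExponent p n k
  maxExponent-max n zero j j≤0 _ = j≤0
  maxExponent-max n (suc k) j j≤1+k p^j∣n with (p ℕ.^ suc k) ∣? n
  ... | yes _     = j≤1+k
  ... | no p^1+k∤n with ℕ.m≤n⇒m<n∨m≡n j≤1+k
  ...   | inj₁ (s≤s j≤k) = maxExponent-max n k j j≤k p^j∣n
  ...   | inj₂ refl      = contradiction p^j∣n p^1+k∤n

  maxExponent-exact : ∀ n z → ∣ z ∣ ≡ suc n → Exact (maxExponent p (suc n) (suc n)) z
  maxExponent-exact n z ∣z∣≡1+n =
    let divides q z≡qp^e = ℤ∣.∣ᵤ⇒∣ {+ (p ℕ.^ e)} {z} (subst (p ℕ.^ e ∣_) (sym ∣z∣≡1+n) (maxExponent-∣ (suc n) (suc n)))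
    in exact q z≡qp^e (p∤q q z≡qp^e)
    where
    e = maxExponent p (suc n) (suc n)
    p∤q : ∀ q → z ≡ q ℤ.* + (p ℕ.^ e) → ¬ (+ p) ∣ᶻ q
    p∤q q z≡qp^e (divides w refl) = ℕ.<-irrefl refl
      -- A factor p in the cofactor gives p^(e+1) ∣ n+1. Then e+1 < p^(e+1) ≤ n+1 keeps e+1 within
      -- the search bound, against the maximality of e.
      (maxExponent-max (suc n) (suc n) (suc e) (ℕ.≤-trans (ℕ.<⇒≤ (n<p^n (suc e))) (∣⇒≤ p^[1+e]∣1+n)) p^[1+e]∣1+n)
      where
      z≡wp^[1+e] : z ≡ w ℤ.* + (p ℕ.^ suc e)
      z≡wp^[1+e] = trans z≡qp^e (trans (ℤ.*-assoc w (+ p) _) (cong (w ℤ.*_) (sym (ℤ.pos-* p (p ℕ.^ e)))))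
      p^[1+e]∣1+n : p ℕ.^ suc e ∣ suc n
      p^[1+e]∣1+n = subst (p ℕ.^ suc e ∣_) ∣z∣≡1+n (ℤ∣.∣⇒∣ᵤ {+ (p ℕ.^ suc e)} (divides w z≡wp^[1+e]))

  v-exact : ∀ {z e} → v p z ≡ [ e ] → Exact e z
  v-exact {+ suc n}    refl = maxExponent-exact n (+ suc n) refl
  v-exact { -[1+ n ] } refl = maxExponent-exact n -[1+ n ] refl

  v-finite : ∀ n .{{_ : NonZero n}} → ∃[ e ] v p (+ n) ≡ [ e ]
  v-finite (suc n) = _ , refl

  exponent : ℕ₊ → ℕ
  exponent (mk n) = proj₁ (v-finite n)

  exponent-exact : ∀ n → Exact (exponent n) (+ ℕ₊.value n)
  exponent-exact (mk n) = v-exact (proj₂ (v-finite n))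

  -- An infinite argument makes the maximum infinite. Applied to v(b) and v(d) below the finite
  -- v(a), this shows that b and d are non-zero.
  <⁺-finite : ∀ {x y k} → x ⊔⁺ y <⁺ [ k ] → ∃[ i ] ∃[ j ] x ≡ [ i ] × y ≡ [ j ] × i ℕ.< k × j ℕ.< k
  <⁺-finite {[ i ]} {[ j ]} lt =
    let i⊔j<k = [<]-injective lt
    in i , j , refl , refl , ℕ.m⊔n<o⇒m<o i j i⊔j<k , ℕ.m⊔n<o⇒n<o i j i⊔j<k
  <⁺-finite {[ i ]} {⊤⁺} ()
  <⁺-finite {⊤⁺} ()

  -- Since k < l, the term ax is divisible by p^(k+1), so the valuation does not depend on x.
  exact-affine : ∀ {k l a z} x → Exact l a → k ℕ.< l → Exact k z → Exact k (a ℤ.* x ℤ.+ z)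
  exact-affine {k} {l} {a} x (exact q refl _) k<l = exact-+ (ℤ∣.∣m⇒∣m*n x (ℤ∣.∣n⇒∣m*n q
    (divides (+ (p ℕ.^ (l ℕ.∸ suc k))) (trans (cong (λ l → + (p ℕ.^ l)) (sym (ℕ.m∸n+n≡m k<l)))
      (pos-^-+ (l ℕ.∸ suc k) (suc k))))))

-- Proper colourings and residues

colourable : ∀ {S k} (f : ℕ₊ → Fin k) → (∀ m n → member S (ratio m n) → f m ≢ f n) → Colourable G[ S ] k
colourable {S} f separates = f , proper
  where
  proper : ∀ {m n} → Graph.Adj G[ S ] m n → f m ≢ f n
  proper (inj₁ m/n∈S) = separates _ _ m/n∈S
  proper (inj₂ n/m∈S) = ≢-sym (separates _ _ n/m∈S)

-- With equal residues the inequalities pass to the quotients and become j/k < i/k < 1 + j/k.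
%-distinct : ∀ i j k .{{_ : NonZero k}} → j ℕ.< i → i ℕ.< j ℕ.+ k → i % k ≢ j % k
%-distinct i j k j<i i<j+k i%k≡j%k = ℕ.<-irrefl refl (ℕ.<-≤-trans i/k<1+j/k j/k<i/k)
  where
  split : i ≡ j % k ℕ.+ i / k ℕ.* k
  split = trans (m≡m%n+[m/n]*n i k) (cong (ℕ._+ i / k ℕ.* k) i%k≡j%k)
  j/k<i/k : j / k ℕ.< i / k
  j/k<i/k = ℕ.*-cancelʳ-< k _ _ (ℕ.+-cancelˡ-< (j % k) _ _ (subst₂ ℕ._<_ (m≡m%n+[m/n]*n j k) split j<i))
  i/k<1+j/k : i / k ℕ.< suc (j / k)
  i/k<1+j/k = ℕ.*-cancelʳ-< k _ _ (ℕ.+-cancelˡ-< (j % k) _ _ (subst₂ ℕ._<_ split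
    (trans (cong (ℕ._+ k) (m≡m%n+[m/n]*n j k))
      (trans (ℕ.+-assoc (j % k) _ k) (cong (j % k ℕ.+_) (ℕ.+-comm _ k)))) i<j+k))

mod-injective : ∀ i j k .{{_ : NonZero k}} → i mod k ≡ j mod k → i % k ≡ j % k
mod-injective i j k eq = trans (sym (toℕ-fromℕ< (m%n<n i k))) (trans (cong toℕ eq) (toℕ-fromℕ< (m%n<n j k)))

mod-distinct : ∀ i j k .{{_ : NonZero k}} → j ℕ.< i → i ℕ.< j ℕ.+ k → i mod k ≢ j mod k
mod-distinct i j k j<i i<j+k eq = %-distinct i j k j<i i<j+k (mod-injective i j k eq)

[h+n]/h : ∀ h n .{{_ : NonZero h}} → (h ℕ.+ n) / h ≡ suc (n / h)
[h+n]/h h n = trans (+-distrib-/-∣ˡ n ∣-refl) (cong (ℕ._+ n / h) (n/n≡1 h))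

+≡+⇒≡∸+ : ∀ {i j x y} → i ℕ.< j → y ℕ.+ i ≡ x ℕ.+ j → y ≡ j ℕ.∸ i ℕ.+ x
+≡+⇒≡∸+ {i} {j} {x} {y} i<j y+i≡x+j = ℕ.+-cancelʳ-≡ i y (j ℕ.∸ i ℕ.+ x) (begin
  y ℕ.+ i                ≡⟨ y+i≡x+j ⟩
  x ℕ.+ j                ≡⟨ cong (x ℕ.+_) (ℕ.m∸n+n≡m (ℕ.<⇒≤ i<j)) ⟨
  x ℕ.+ (j ℕ.∸ i ℕ.+ i)  ≡⟨ ℕ.+-assoc x (j ℕ.∸ i) i ⟨
  x ℕ.+ (j ℕ.∸ i) ℕ.+ i  ≡⟨ cong (ℕ._+ i) (ℕ.+-comm x (j ℕ.∸ i)) ⟩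
  j ℕ.∸ i ℕ.+ x ℕ.+ i    ∎)
  where open ≡-Reasoning

-- Colouring by valuations

module UnequalValuations {p : ℕ} (p-prime : Prime p) where
  open Valuation p-prime

  colourOf : (h : ℕ) .{{_ : NonZero h}} → ℕ₊ → Fin 2
  colourOf h n = (exponent n / h) mod 2

  -- Adding h to the exponent raises its quotient by h by exactly 1, so the parity changes.
  colourOf-≢ : ∀ h .{{_ : NonZero h}} m n → exponent m ≡ h ℕ.+ exponent n → colourOf h m ≢ colourOf h n
  colourOf-≢ h m n eq = mod-distinct (exponent m / h) (exponent n / h) 2
    (ℕ.≤-reflexive (sym quotient)) (ℕ.≤-reflexive (trans (cong suc quotient) (ℕ.+-comm 2 (exponent n / h))))
    where
    quotient : exponent m / h ≡ suc (exponent n / h)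
    quotient = trans (cong (_/ h) eq) ([h+n]/h h (exponent n))

  module _ {a b d i j k} (Ea : Exact k (+ a)) (i<k : i ℕ.< k) (j<k : j ℕ.< k) (Eb : Exact i b) (Ed : Exact j d) where

    -- Compare valuations in m(ax+d) = n(ax+b), where the affine factors have valuations j and i for
    -- every x.
    adjacent⇒exponents : ∀ m n → member (R a b a d) (ratio m n) → exponent m ℕ.+ j ≡ exponent n ℕ.+ i
    adjacent⇒exponents m n m/n∈R =
      let x , eq = adjacent⇒equation {a} {b} {a} {d} m n m/n∈R
      in exact-unique (exact-* (exponent-exact m) (exact-affine (+ x) Ea j<k Ed))
           (subst (Exact _) (sym eq) (exact-* (exponent-exact n) (exact-affine (+ x) Ea i<k Eb)))

    2-colourable : i ≢ j → Colourable (G a b a d) 2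
    2-colourable i≢j with ℕ.<-cmp i j
    ... | tri≈ _ i≡j _ = contradiction i≡j i≢j
    -- For i < j it is n that has the larger exponent, by j - i, so the roles of m and n are
    -- exchanged.
    ... | tri< i<j _ _ = colourable {R a b a d} (colourOf (j ℕ.∸ i)) λ m n m/n∈R →
      ≢-sym (colourOf-≢ (j ℕ.∸ i) n m (+≡+⇒≡∸+ i<j (sym (adjacent⇒exponents m n m/n∈R))))
      where instance _ = ℕ.>-nonZero (ℕ.m<n⇒0<n∸m i<j)
    ... | tri> _ _ j<i = colourable {R a b a d} (colourOf (i ℕ.∸ j)) λ m n m/n∈R →
      colourOf-≢ (i ℕ.∸ j) m n (+≡+⇒≡∸+ j<i (adjacent⇒exponents m n m/n∈R))
      where instance _ = ℕ.>-nonZero (ℕ.m<n⇒0<n∸m j<i)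

-- Existence of an edge

equation⇒member : ∀ {a b c d r} (x : ℕ₊) → let X = ι (+ a ℤ.* + ℕ₊.value x ℤ.+ b); Y = ι (+ c ℤ.* + ℕ₊.value x ℤ.+ d) in
  0ℚ ℚ.< X → 0ℚ ℚ.< Y → X ≢ Y → r ℚ.* Y ≡ X → member (R a b c d) r
equation⇒member {a} {b} {c} {d} {r} x 0<X 0<Y X≢Y rY≡X =
  (x , nz , trans (trans (sym (ℚ.*-identityʳ r)) (cong (r ℚ.*_) (sym (ℚ.*-inverseʳ Y {{nz}}))))
    (trans (sym (ℚ.*-assoc r Y _)) (cong (ℚ._* (1/ Y) {{nz}}) rY≡X))) ,
  ℚ.*-cancelʳ-<-nonNeg Y {{ℚ.nonNegative (ℚ.<⇒≤ 0<Y)}} (subst₂ ℚ._<_ (sym (ℚ.*-zeroˡ Y)) (sym rY≡X) 0<X) ,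
  λ r≡1 → X≢Y (trans (sym rY≡X) (trans (cong (ℚ._* Y) r≡1) (ℚ.*-identityˡ Y)))
  where
  X = ι (+ a ℤ.* + ℕ₊.value x ℤ.+ b)
  Y = ι (+ c ℤ.* + ℕ₊.value x ℤ.+ d)
  nz : ℚ.NonZero Y
  nz = ℚ.pos⇒nonZero Y {{ℚ.positive 0<Y}}

-- Because a ≥ 1 and x > ∣b∣, one has ax+b ≥ x+b > 0.
affine-positive : ∀ a b x .{{_ : NonZero a}} → ∣ b ∣ ℕ.< x → ∃[ n ] + a ℤ.* + x ℤ.+ b ≡ + suc n
affine-positive a b x ∣b∣<x = toSuc _ (ℤ.<-≤-trans 0<x+b
  (ℤ.+-monoˡ-≤ b (subst (+ x ℤ.≤_) (ℤ.pos-* a x) (ℤ.+≤+ (ℕ.m≤n*m x a)))))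
  where
  toSuc : ∀ z → ℤ.0ℤ ℤ.< z → ∃[ n ] z ≡ + suc n
  toSuc (+ suc n) _ = n , refl
  toSuc (+ zero) (ℤ.+<+ ())
  -∣b∣≤b : ∀ b → ℤ.- + ∣ b ∣ ℤ.≤ b
  -∣b∣≤b (+ zero) = ℤ.≤-refl
  -∣b∣≤b (+ suc n) = ℤ.-≤+
  -∣b∣≤b -[1+ n ] = ℤ.≤-refl
  0<x+b : ℤ.0ℤ ℤ.< + x ℤ.+ b
  0<x+b = subst (ℤ._< + x ℤ.+ b) (ℤ.+-inverseʳ (+ ∣ b ∣)) (ℤ.+-mono-<-≤ (ℤ.+<+ ∣b∣<x) (-∣b∣≤b b))

-- For the lower bound 2 in (iii). With x larger than ∣b∣ and ∣d∣, the numbers ax+b and ax+d are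
-- positive and are themselves adjacent vertices.
edge : ∀ a b d .{{_ : NonZero a}} → b ≢ d → ∃[ m ] ∃[ n ] member (R a b a d) (ratio m n)
edge a b d b≢d =
  let M , X≡ = affine-positive a b x (s≤s (ℕ.m≤m+n ∣ b ∣ ∣ d ∣))
      N , Y≡ = affine-positive a d x (s≤s (ℕ.m≤n+m ∣ d ∣ ∣ b ∣))
      positive : ∀ {z n} → z ≡ + suc n → 0ℚ ℚ.< ι z
      positive eq = ι-mono-< (subst (ℤ.0ℤ ℤ.<_) (sym eq) (ℤ.+<+ (s≤s z≤n)))
  in mk (suc M) , mk (suc N) ,
     equation⇒member {a} {b} {a} {d} (mk x) (positive X≡) (positive Y≡)
       (λ eq → b≢d (∙-cancelˡ (+ a ℤ.* + x) b d (ι-injective eq)))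
       (subst₂ (λ X Y → ratio (mk (suc M)) (mk (suc N)) ℚ.* ι Y ≡ ι X) (sym X≡) (sym Y≡)
         (ratio-* (mk (suc M)) (mk (suc N))))
  where
  x = suc (∣ b ∣ ℕ.+ ∣ d ∣)

adjacent⇒2≤ : ∀ (Γ : Graph) {u w} → Graph.Adj Γ u w → ∀ j → Colourable Γ j → 2 ℕ.≤ j
adjacent⇒2≤ Γ {u} uw 0 (f , _) with () ← f u
adjacent⇒2≤ Γ {u} {w} uw 1 (f , proper) with f u | f w | proper uw
... | zero | zero | f≢ = contradiction refl f≢
adjacent⇒2≤ Γ uw (suc (suc j)) _ = s≤s (s≤s z≤n)

-- Colouring by p-free parts

module EqualValuations {p : ℕ} (p-prime : Prime p) (e : ℕ) where
  open Valuation p-prime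

  private instance
    p≢0 : NonZero p
    p≢0 = prime⇒nonZero p-prime

    p^e≢0 : NonZero (p ℕ.^ e)
    p^e≢0 = ℕ.m^n≢0 p e

  cofactor : ℕ₊ → ℕ
  cofactor n = ∣ Exact.cofactor (exponent-exact n) ∣

  cofactor-factorises : ∀ n → ℕ₊.value n ≡ cofactor n ℕ.* p ℕ.^ exponent n
  cofactor-factorises n = trans (cong ∣_∣ (Exact.factorises E))
    (ℤ.∣i*j∣≡∣i∣*∣j∣ (Exact.cofactor E) (+ (p ℕ.^ exponent n)))
    where E = exponent-exact n

  p∤cofactor : ∀ n → ¬ p ∣ cofactor n
  p∤cofactor n p∣q = Exact.coprime (exponent-exact n) (ℤ∣.∣ᵤ⇒∣ p∣q)

  cofactor%p≢0 : ∀ n → NonZero (cofactor n % p)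
  cofactor%p≢0 n = ℕ.≢-nonZero λ eq → p∤cofactor n (m%n≡0⇒n∣m (cofactor n) p eq)

  pred-residue<p-1 : ∀ n → ℕ.pred (cofactor n % p) ℕ.< p ℕ.∸ 1
  pred-residue<p-1 n = ℕ.pred-mono-< {{cofactor%p≢0 n}} (m%n<n (cofactor n) p)

  -- A unit modulo p^(e+1), encoded by its last base-p digit, which is non-zero and therefore
  -- lowered by 1, and by its other e digits. This gives exactly p^e (p-1) colours.
  colourOf : ℕ₊ → Fin (p ℕ.^ e ℕ.* (p ℕ.∸ 1))
  colourOf n = combine ((cofactor n / p) mod (p ℕ.^ e)) (fromℕ< (pred-residue<p-1 n))

  -- Expand u as u%p + ((u/p)%P + (u/p/P) P) p with P = p^e. Equal colours cancel everything but the
  -- multiples of pP.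
  colourOf-≡⇒∣ : ∀ m n → colourOf m ≡ colourOf n → + (p ℕ.^ suc e) ∣ᶻ + cofactor m ℤ.- + cofactor n
  colourOf-≡⇒∣ m n eq = divides (+ s ℤ.- + t) (begin
    + q ℤ.- + r
      ≡⟨ cong₂ ℤ._-_ (expand q) (expand r) ⟩
    (+ (q % p) ℤ.+ (+ (q / p % P) ℤ.+ + s ℤ.* + P) ℤ.* + p) ℤ.- (+ (r % p) ℤ.+ (+ (r / p % P) ℤ.+ + t ℤ.* + P) ℤ.* + p)
      ≡⟨ cong₂ (λ x y → (+ x ℤ.+ (+ y ℤ.+ + s ℤ.* + P) ℤ.* + p) ℤ.-
           (+ (r % p) ℤ.+ (+ (r / p % P) ℤ.+ + t ℤ.* + P) ℤ.* + p)) residues quotients ⟩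
    (+ (r % p) ℤ.+ (+ (r / p % P) ℤ.+ + s ℤ.* + P) ℤ.* + p) ℤ.- (+ (r % p) ℤ.+ (+ (r / p % P) ℤ.+ + t ℤ.* + P) ℤ.* + p)
      ≡⟨ difference (+ (r % p)) (+ (r / p % P)) (+ s) (+ t) (+ P) (+ p) ⟩
    (+ s ℤ.- + t) ℤ.* (+ p ℤ.* + P)
      ≡⟨ cong ((+ s ℤ.- + t) ℤ.*_) (ℤ.pos-* p P) ⟨
    (+ s ℤ.- + t) ℤ.* + (p ℕ.* P)
      ∎)
    where
    open ≡-Reasoning
    P = p ℕ.^ e
    q = cofactor m
    r = cofactor n
    s = q / p / P
    t = r / p / P

    components = combine-injective ((q / p) mod P) (fromℕ< (pred-residue<p-1 m))
      ((r / p) mod P) (fromℕ< (pred-residue<p-1 n)) eq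

    quotients : q / p % P ≡ r / p % P
    quotients = mod-injective (q / p) (r / p) P (proj₁ components)

    residues : q % p ≡ r % p
    residues = ℕ.pred-injective {{cofactor%p≢0 m}} {{cofactor%p≢0 n}}
      (trans (sym (toℕ-fromℕ< (pred-residue<p-1 m)))
        (trans (cong toℕ (proj₂ components)) (toℕ-fromℕ< (pred-residue<p-1 n))))

    pos-divMod : ∀ u k .{{_ : NonZero k}} → + u ≡ + (u % k) ℤ.+ + (u / k) ℤ.* + k
    pos-divMod u k = trans (cong +_ (m≡m%n+[m/n]*n u k)) (cong (λ z → + (u % k) ℤ.+ z) (ℤ.pos-* (u / k) k))

    expand : ∀ u → + u ≡ + (u % p) ℤ.+ (+ (u / p % P) ℤ.+ + (u / p / P) ℤ.* + P) ℤ.* + p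
    expand u = trans (pos-divMod u p) (cong (λ z → + (u % p) ℤ.+ z ℤ.* + p) (pos-divMod (u / p) P))

    difference : ∀ x y s t P p →
      (x ℤ.+ (y ℤ.+ s ℤ.* P) ℤ.* p) ℤ.- (x ℤ.+ (y ℤ.+ t ℤ.* P) ℤ.* p) ≡ (s ℤ.- t) ℤ.* (p ℤ.* P)
    difference = solveᶻ-∀

  module _ {a b d k i} (Ea : Exact k (+ a))
    (i<k : i ℕ.< k) (Eb : Exact i b) (Ed : Exact i d) (Eb-d : Exact e (b ℤ.- d)) where

    -- As b and d have equal valuations, so have m and n, and the power of p cancels from mY = nX.
    -- Subtracting NY from MY = NX leaves N(X - Y) = N(b - d) on the right; the witness y is Y =
    -- ax+d.
    adjacent⇒cofactors : ∀ m n → member (R a b a d) (ratio m n) →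
      ∃[ y ] (+ cofactor m ℤ.- + cofactor n) ℤ.* y ≡ + cofactor n ℤ.* (b ℤ.- d)
    adjacent⇒cofactors m n m/n∈R = let x , eq = adjacent⇒equation {a} {b} {a} {d} m n m/n∈R in _ , cofactors x eq
      where
      open ≡-Reasoning
      M = + cofactor m
      N = + cofactor n
      P = p ℕ.^ exponent n

      exponents : exponent m ≡ exponent n
      exponents = ℕ.+-cancelʳ-≡ i _ _ (UnequalValuations.adjacent⇒exponents p-prime Ea i<k i<k Eb Ed m n m/n∈R)

      value≡ : ∀ n → + ℕ₊.value n ≡ + cofactor n ℤ.* + (p ℕ.^ exponent n)
      value≡ n = trans (cong +_ (cofactor-factorises n)) (ℤ.pos-* (cofactor n) (p ℕ.^ exponent n))

      swap : ∀ x y z → x ℤ.* y ℤ.* z ≡ x ℤ.* z ℤ.* y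
      swap = solveᶻ-∀

      distrib : ∀ x y z → (x ℤ.- y) ℤ.* z ≡ x ℤ.* z ℤ.- y ℤ.* z
      distrib = solveᶻ-∀

      difference : ∀ n x b d → n ℤ.* (x ℤ.+ b) ℤ.- n ℤ.* (x ℤ.+ d) ≡ n ℤ.* (b ℤ.- d)
      difference = solveᶻ-∀

      cancel-power : ∀ X Y → + ℕ₊.value m ℤ.* Y ≡ + ℕ₊.value n ℤ.* X → M ℤ.* Y ≡ N ℤ.* X
      cancel-power X Y eq = ℤ.*-cancelʳ-≡ (M ℤ.* Y) (N ℤ.* X) (+ P) {{ℕ.m^n≢0 p (exponent n)}} (begin
        M ℤ.* Y ℤ.* + P                    ≡⟨ swap M Y (+ P) ⟩
        M ℤ.* + P ℤ.* Y                    ≡⟨ cong (λ i → M ℤ.* + (p ℕ.^ i) ℤ.* Y) exponents ⟨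
        M ℤ.* + (p ℕ.^ exponent m) ℤ.* Y   ≡⟨ cong (ℤ._* Y) (value≡ m) ⟨
        + ℕ₊.value m ℤ.* Y                 ≡⟨ eq ⟩
        + ℕ₊.value n ℤ.* X                 ≡⟨ cong (ℤ._* X) (value≡ n) ⟩
        N ℤ.* + P ℤ.* X                    ≡⟨ swap N (+ P) X ⟩
        N ℤ.* X ℤ.* + P                    ∎)

      cofactors : ∀ x → let X = + a ℤ.* + x ℤ.+ b; Y = + a ℤ.* + x ℤ.+ d in
        + ℕ₊.value m ℤ.* Y ≡ + ℕ₊.value n ℤ.* X → (M ℤ.- N) ℤ.* Y ≡ N ℤ.* (b ℤ.- d)
      cofactors x eq = begin
        (M ℤ.- N) ℤ.* Y              ≡⟨ distrib M N Y ⟩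
        M ℤ.* Y ℤ.- N ℤ.* Y          ≡⟨ cong (ℤ._- N ℤ.* Y) (cancel-power X Y eq) ⟩
        N ℤ.* X ℤ.- N ℤ.* Y          ≡⟨ difference N (+ a ℤ.* + x) b d ⟩
        N ℤ.* (b ℤ.- d)              ∎
        where
        X = + a ℤ.* + x ℤ.+ b
        Y = + a ℤ.* + x ℤ.+ d

    p^e[p-1]-colourable : Colourable (G a b a d) (p ℕ.^ e ℕ.* (p ℕ.∸ 1))
    p^e[p-1]-colourable = colourable {R a b a d} colourOf λ m n m/n∈R eq →
      let y , eq′ = adjacent⇒cofactors m n m/n∈R
          exact-cofactor = exact (+ cofactor n) (sym (ℤ.*-identityʳ (+ cofactor n))) λ p∣q → p∤cofactor n (ℤ∣.∣⇒∣ᵤ p∣q)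
      -- Equal colours would make p^(e+1) divide n′(b-d), whose valuation is exactly e because n′ is
      -- prime to p.
      in ℕ.<-irrefl refl (∣⇒≤-exact {suc e}
           (subst (+ (p ℕ.^ suc e) ∣ᶻ_) eq′ (ℤ∣.∣m⇒∣m*n y (colourOf-≡⇒∣ m n eq)))
           (exact-* {0} exact-cofactor Eb-d))

-- Logarithms

cancelˡ-< : ∀ {p q r} → 0ℚ ℚ.< r → r ℚ.* p ℚ.< r ℚ.* q → p ℚ.< q
cancelˡ-< {r = r} 0<r = ℚ.*-cancelˡ-<-nonNeg r {{ℚ.nonNegative (ℚ.<⇒≤ 0<r)}}

cancelʳ-< : ∀ {p q r} → 0ℚ ℚ.< r → p ℚ.* r ℚ.< q ℚ.* r → p ℚ.< q
cancelʳ-< {r = r} 0<r = ℚ.*-cancelʳ-<-nonNeg r {{ℚ.nonNegative (ℚ.<⇒≤ 0<r)}}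

cancelˡ-≤ : ∀ {p q r} → 0ℚ ℚ.< r → r ℚ.* p ℚ.≤ r ℚ.* q → p ℚ.≤ q
cancelˡ-≤ {r = r} 0<r = ℚ.*-cancelˡ-≤-pos r {{ℚ.positive 0<r}}

cancelʳ-≤ : ∀ {p q r} → 0ℚ ℚ.< r → p ℚ.* r ℚ.≤ q ℚ.* r → p ℚ.≤ q
cancelʳ-≤ {r = r} 0<r = ℚ.*-cancelʳ-≤-pos r {{ℚ.positive 0<r}}

pq≡1⇒[xp]q≡x : ∀ {p q} x → p ℚ.* q ≡ 1ℚ → x ℚ.* p ℚ.* q ≡ x
pq≡1⇒[xp]q≡x {p} {q} x pq≡1 = trans (ℚ.*-assoc x p q) (trans (cong (x ℚ.*_) pq≡1) (ℚ.*-identityʳ x))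

ι-*⁺ : ∀ m n → ι (+ (m ℕ.* n)) ≡ ι (+ m) ℚ.* ι (+ n)
ι-*⁺ m n = trans (cong ι (ℤ.pos-* m n)) (ι-* (+ m) (+ n))

upper-positive : ∀ (x : ℝ⁺) {u} → upper (real x) u → 0ℚ ℚ.< u
upper-positive (pos x (l , 0<l , Ll)) Uu = ℚ.<-trans 0<l (disjoint x Ll Uu)

-- By Bernoulli ρ^N ≥ 1 + N(ρ-1), and N > x/(ρ-1) exists by the Archimedean property.
powers-unbounded : ∀ {ρ} → 1ℚ ℚ.< ρ → ∀ x → ∃[ n ] x ℚ.< ρ ^ℚ suc n
powers-unbounded {ρ} 1<ρ x with recip (0<q-p 1<ρ)
... | h , 0<h , [ρ-1]h≡1 with archimedean (x ℚ.* h)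
... | n , xh<N = n , (begin-strict
  x                                        ≡⟨ pq≡1⇒[xp]q≡x x (trans (ℚ.*-comm h (ρ ℚ.- 1ℚ)) [ρ-1]h≡1) ⟨
  x ℚ.* h ℚ.* (ρ ℚ.- 1ℚ)                   <⟨ *-monoˡ-< (0<q-p 1<ρ) xh<N ⟩
  ι (+ suc n) ℚ.* (ρ ℚ.- 1ℚ)               ≤⟨ ≤-by 1ℚ (ℚ.<⇒≤ 0<1) (ℚ.+-comm 1ℚ (ι (+ suc n) ℚ.* (ρ ℚ.- 1ℚ))) ⟩
  1ℚ ℚ.+ ι (+ suc n) ℚ.* (ρ ℚ.- 1ℚ)        ≤⟨ bernoulli (ℚ.≤-trans
                                               (ℚ.<⇒≤ (ℚ.neg-antimono-< 0<1)) (ℚ.<⇒≤ (0<q-p 1<ρ))) (suc n) ⟩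
  (1ℚ ℚ.+ (ρ ℚ.- 1ℚ)) ^ℚ suc n              ≡⟨ cong (_^ℚ suc n) (p≡q+[p-q] ρ 1ℚ) ⟨
  ρ ^ℚ suc n                                ∎)
  where open ℚ.≤-Reasoning

module LogRatio (x y : ℝ⁺) (1<x : 1ℝ <ℝ real x) (1<y : 1ℝ <ℝ real y) (k : ℕ)
  (ratio≤k : real (log⁺ x 1<x /ℝ log⁺ y 1<y) ≤ℝ fromℚ (ι (+ k))) where

  K : ℚ
  K = ι (+ k)

  0≤K : 0ℚ ℚ.≤ K
  0≤K = ι-nonNeg k

  -- An upper bound u of log y and a lower bound greater than k u of log x would give log x / log y > k.
  log-x≤K*log-y : ∀ {u} → 0ℚ ℚ.< u → upper (log y) u → ¬ lower (log x) (K ℚ.* u)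
  log-x≤K*log-y {u} 0<u Uu L[Ku] =
    let q , Ku<q , Lq   = lower-open (log x) L[Ku]
        g , 0<g , ug≡1  = recip 0<u
        0<q             = ℚ.≤-<-trans (*-nonNeg 0≤K (ℚ.<⇒≤ 0<u)) Ku<q
        h , 0<h , qh≡1  = recip 0<q
        K<qg            = subst (ℚ._< q ℚ.* g) (pq≡1⇒[xp]q≡x K ug≡1) (*-monoˡ-< 0<g Ku<q)
        -- The cuts are open, so strict room is needed twice: K₁ separates k from the quotient of
        -- logarithms, and K₂ > K₁ is a lower bound of that quotient, as the product of q and K₂/q <
        -- 1/u.
        K₁ , K<K₁ , K₁<qg = ℚ.<-dense K<qg
        K₂ , K₁<K₂ , K₂<qg = ℚ.<-dense K₁<qg
        hq≡1            = trans (ℚ.*-comm h q) qh≡1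
        K₂h<g           = cancelʳ-< 0<q (subst₂ ℚ._<_ (sym (pq≡1⇒[xp]q≡x K₂ hq≡1)) (ℚ.*-comm q g) K₂<qg)
        0<K₂            = ℚ.≤-<-trans 0≤K (ℚ.<-trans K<K₁ K₁<K₂)
    in ratio≤k (K₁ , K<K₁ , K₂ , K₁<K₂ , q , K₂ ℚ.* h , 0<q , *-pos 0<K₂ 0<h , Lq ,
         (g , K₂h<g , u , Uu , ℚ.≤-reflexive (trans (ℚ.*-comm g u) ug≡1)) ,
         ℚ.≤-reflexive (sym (trans (ℚ.*-comm q (K₂ ℚ.* h)) (pq≡1⇒[xp]q≡x K₂ hq≡1))))

  -- The slack 1/W in r ≤ (k + 1/W) l is what finding l and r by approximation costs;
  -- it disappears as W = M + 1 grows.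
  exponentiate : ∀ M {l r} → ι (+ suc M) ℚ.* r ℚ.≤ ι (+ suc (k ℕ.* suc M)) ℚ.* l → lower (log y) l → upper (log x) r →
    ∃[ s ] ∃[ u ] 0ℚ ℚ.< s × lower (real y) s × upper (real x) u × u ^ℚ suc M ℚ.≤ s ^ℚ suc (k ℕ.* suc M)
  exponentiate M {l} {r} Wr≤Vl
    (l′ , l<l′ , n , δ , l′≤nδ , δ<1 , s , Ls , 1≤s[1-δ]ⁿ) (r′ , r′<r , m , δ′ , mδ′≤r′ , -1<δ′ , u , Uu , u≤[1+δ′]ᵐ) =
    -- `u ≤ A` certifies r′ as an upper bound of log x, and `1 ≤ s B` certifies l′ as a lower bound
    -- of log y. Raised to the powers W and V they combine through `AᵂBⱽ≤1`.
    s , u , 0<s , Ls , Uu , (begin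
      u ^ℚ W                                  ≡⟨ ℚ.*-identityʳ (u ^ℚ W) ⟨
      u ^ℚ W ℚ.* 1ℚ                           ≤⟨ *-monoʳ-≤ (^-nonNeg 0≤u W) (1≤^ 1≤s[1-δ]ⁿ V) ⟩
      u ^ℚ W ℚ.* (s ℚ.* B) ^ℚ V                ≡⟨ cong (u ^ℚ W ℚ.*_) (^-distrib-* s B V) ⟩
      u ^ℚ W ℚ.* (s ^ℚ V ℚ.* B ^ℚ V)            ≤⟨ *-monoˡ-≤ (*-nonNeg
                                                 (^-nonNeg (ℚ.<⇒≤ 0<s) V) (^-nonNeg (ℚ.<⇒≤ 0<B) V)) (^-mono-≤ 0≤u u≤[1+δ′]ᵐ W) ⟩
      A ^ℚ W ℚ.* (s ^ℚ V ℚ.* B ^ℚ V)            ≡⟨ solve 3 (λ a s b → a :* (s :* b) := s :* (a :* b)) refl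
                                                 (A ^ℚ W) (s ^ℚ V) (B ^ℚ V) ⟩
      s ^ℚ V ℚ.* (A ^ℚ W ℚ.* B ^ℚ V)            ≤⟨ *-monoʳ-≤ (^-nonNeg (ℚ.<⇒≤ 0<s) V) AᵂBⱽ≤1 ⟩
      s ^ℚ V ℚ.* 1ℚ                           ≡⟨ ℚ.*-identityʳ (s ^ℚ V) ⟩
      s ^ℚ V                                  ∎)
    where
    open ℚ.≤-Reasoning
    W = suc M
    V = suc (k ℕ.* suc M)
    A = (1ℚ ℚ.+ δ′) ^ℚ suc m
    B = (1ℚ ℚ.- δ) ^ℚ suc n
    0<B = ^-pos (0<q-p δ<1) (suc n)
    0≤u = ℚ.<⇒≤ (upper-positive x Uu)
    0<s : 0ℚ ℚ.< s
    0<s = cancelʳ-< 0<B (ℚ.<-≤-trans (ℚ.≤-<-trans (ℚ.≤-reflexive (ℚ.*-zeroˡ B)) 0<1) 1≤s[1-δ]ⁿ)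
    mWδ′≤nVδ : ι (+ (suc m ℕ.* W)) ℚ.* δ′ ℚ.≤ ι (+ (suc n ℕ.* V)) ℚ.* δ
    mWδ′≤nVδ = begin
      ι (+ (suc m ℕ.* W)) ℚ.* δ′                 ≡⟨ cong (ℚ._* δ′) (ι-*⁺ (suc m) W) ⟩
      ι (+ suc m) ℚ.* ι (+ W) ℚ.* δ′             ≡⟨ solve 3 (λ m w δ → m :* w :* δ := w :* (m :* δ)) refl
                                                     (ι (+ suc m)) (ι (+ W)) δ′ ⟩
      ι (+ W) ℚ.* (ι (+ suc m) ℚ.* δ′)           ≤⟨ *-monoʳ-≤ (ι-nonNeg W) (ℚ.≤-trans mδ′≤r′ (ℚ.<⇒≤ r′<r)) ⟩
      ι (+ W) ℚ.* r                              ≤⟨ Wr≤Vl ⟩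
      ι (+ V) ℚ.* l                              ≤⟨ *-monoʳ-≤ (ι-nonNeg V) (ℚ.≤-trans (ℚ.<⇒≤ l<l′) l′≤nδ) ⟩
      ι (+ V) ℚ.* (ι (+ suc n) ℚ.* δ)            ≡⟨ solve 3 (λ v n δ → v :* (n :* δ) := n :* v :* δ) refl
                                                     (ι (+ V)) (ι (+ suc n)) δ ⟩
      ι (+ suc n) ℚ.* ι (+ V) ℚ.* δ              ≡⟨ cong (ℚ._* δ) (ι-*⁺ (suc n) V) ⟨
      ι (+ (suc n ℕ.* V)) ℚ.* δ                  ∎
    AᵂBⱽ≤1 : A ^ℚ W ℚ.* B ^ℚ V ℚ.≤ 1ℚ
    AᵂBⱽ≤1 = subst (ℚ._≤ 1ℚ) (sym (cong₂ ℚ._*_ (^-assocʳ (1ℚ ℚ.+ δ′) (suc m) W) (^-assocʳ (1ℚ ℚ.- δ) (suc n) V)))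
      -- `exp-bounds` takes predecessors of exponents; these arguments are (m+1)W - 1 and (n+1)V -
      -- 1.
      (exp-bounds (M ℕ.+ m ℕ.* W) (k ℕ.* W ℕ.+ n ℕ.* V) mWδ′≤nVδ δ<1 -1<δ′)

  -- The real inequality log x ≤ k log y turned into one between powers of rationals: u above x and
  -- s below y satisfy u ≤ s^(k+1/W), where W = M + 1.
  power-bound : ∀ M → ∃[ s ] ∃[ u ] 0ℚ ℚ.< s × lower (real y) s × upper (real x) u × u ^ℚ suc M ℚ.≤ s ^ℚ suc (k ℕ.* suc M)
  power-bound M =
    let l₀ , 0<l₀ , Ll₀       = Log.log-positive (real y) (0<real y) 1<y
        h , 0<h , Vh≡1        = recip 0<V
        w , 0<w , Ww≡1        = recip 0<W
        -- The choice ε = l₀/V is small enough for WK(l+ε) < Vl: as V = 1 + KW, one has KWε = l₀ - ε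
        -- < l.
        0<ε                   = *-pos 0<l₀ 0<h
        l , l₀≤l , Ll , U[l+ε] = approximate (log y) Ll₀ 0<ε
        0<l                   = ℚ.<-≤-trans 0<l₀ l₀≤l
        wW≡1                  = trans (ℚ.*-comm w W) Ww≡1
        W[Vlw]≡Vl             = trans (ℚ.*-comm W (V ℚ.* l ℚ.* w)) (pq≡1⇒[xp]q≡x (V ℚ.* l) wW≡1)
        gap                   = cancelˡ-< 0<W (subst (W ℚ.* (K ℚ.* (l ℚ.+ l₀ ℚ.* h)) ℚ.<_)
                                  (sym W[Vlw]≡Vl) (WK[l+ε]<Vl 0<h Vh≡1 0<l₀ l₀≤l))
    -- Locate log x between K(l+ε) and Vl/W. It cannot exceed the first, since l+ε is an upper bound
    -- of log y; hence it is below the second.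
    in Sum.[ (λ L[K[l+ε]] → contradiction L[K[l+ε]] (log-x≤K*log-y (+-pos 0<l 0<ε) U[l+ε]))
            , exponentiate M (ℚ.≤-reflexive W[Vlw]≡Vl) Ll
            ] (located (log x) gap)
     where
     W = ι (+ suc M)
     V = ι (+ suc (k ℕ.* suc M))
     0<W = 0<ι-suc M
     0<V = 0<ι-suc (k ℕ.* suc M)
     V≡ : V ≡ 1ℚ ℚ.+ K ℚ.* W
     V≡ = trans (ι-suc (k ℕ.* suc M)) (cong (λ z → 1ℚ ℚ.+ z) (ι-*⁺ k (suc M)))

     WK[l+ε]<Vl : ∀ {l l₀ h} → 0ℚ ℚ.< h → V ℚ.* h ≡ 1ℚ → 0ℚ ℚ.< l₀ → l₀ ℚ.≤ l →
       W ℚ.* (K ℚ.* (l ℚ.+ l₀ ℚ.* h)) ℚ.< V ℚ.* l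
     WK[l+ε]<Vl {l} {l₀} {h} 0<h Vh≡1 0<l₀ l₀≤l = begin-strict
       W ℚ.* (K ℚ.* (l ℚ.+ l₀ ℚ.* h))           <⟨ <-by (l₀ ℚ.* h) (*-pos 0<l₀ 0<h) (solve 5 (λ w k l l₀ h →
                                                    k :* w :* l :+ (con 1ℚ :+ k :* w) :* h :* l₀ :=
                                                    w :* (k :* (l :+ l₀ :* h)) :+ l₀ :* h) refl W K l l₀ h) ⟩
       K ℚ.* W ℚ.* l ℚ.+ (1ℚ ℚ.+ K ℚ.* W) ℚ.* h ℚ.* l₀ ≡⟨ cong (λ z → K ℚ.* W ℚ.* l ℚ.+ z ℚ.* h ℚ.* l₀) V≡ ⟨
       K ℚ.* W ℚ.* l ℚ.+ V ℚ.* h ℚ.* l₀         ≡⟨ cong (λ z → K ℚ.* W ℚ.* l ℚ.+ z ℚ.* l₀) Vh≡1 ⟩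
       K ℚ.* W ℚ.* l ℚ.+ 1ℚ ℚ.* l₀              ≤⟨ ℚ.+-monoʳ-≤ (K ℚ.* W ℚ.* l) (*-monoʳ-≤ (ℚ.<⇒≤ 0<1) l₀≤l) ⟩
       K ℚ.* W ℚ.* l ℚ.+ 1ℚ ℚ.* l               ≡⟨ solve 3 (λ k w l →
                                                   k :* w :* l :+ con 1ℚ :* l := (con 1ℚ :+ k :* w) :* l) refl K W l ⟩
       (1ℚ ℚ.+ K ℚ.* W) ℚ.* l                   ≡⟨ cong (ℚ._* l) V≡ ⟨
       V ℚ.* l                                  ∎
       where open ℚ.≤-Reasoning

-- Bounding β by a power of a rational

module ProductBound (α β : ℝ⁺) (1<β : 1ℝ <ℝ real β) (k : ℕ)
  (power-bound : ∀ M → ∃[ s ] ∃[ u ] 0ℚ ℚ.< s × lower (real α) s × upper (real (α *ℝ β)) u ×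
    u ^ℚ suc M ℚ.≤ s ^ℚ suc (k ℕ.* suc M)) where

  lower-* : ∀ {s t} → 0ℚ ℚ.< s → 0ℚ ℚ.< t → lower (real α) s → lower (real β) t → lower (real (α *ℝ β)) (s ℚ.* t)
  lower-* 0<s 0<t Ls Lt with lower-open (real β) Lt
  ... | t′ , t<t′ , Lt′ = _ , *-monoʳ-< 0<s t<t′ , _ , _ , 0<s , ℚ.<-trans 0<t t<t′ , Ls , Lt′ , ℚ.≤-refl

  -- For k = 0 and W = 1 the power bound reads u ≤ s with s < α and αβ < u, but a rational b with 1
  -- < b < β gives s < sb < u.
  k≢0 : k ≢ 0
  k≢0 refl =
    let s , u , 0<s , Ls , Uu , u≤s = power-bound 0
        b , 1<b , Lb = 1<β
        sb<u = disjoint (real (α *ℝ β)) (lower-* 0<s (ℚ.<-trans 0<1 1<b) Ls Lb) Uu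
        s<sb = subst (ℚ._< s ℚ.* b) (ℚ.*-identityʳ s) (*-monoʳ-< 0<s 1<b)
    in ℚ.<-irrefl refl (ℚ.<-trans s<sb (ℚ.<-≤-trans sb<u (subst₂ ℚ._≤_ (^-1 u) (^-1 s) u≤s)))

  -- Suppose l exceeds T = s^j and put ρ = l/T > 1. The power bound gives l^W ≤ T^W s for every W,
  -- hence ρ^W ≤ s, although the powers of ρ are unbounded.
  β≤s^[k-1] : ∀ {s} → (∀ t → lower (real α) t → t ℚ.≤ s) → 0ℚ ℚ.< s → ∀ j → k ≡ suc j →
    ∀ {l} → lower (real β) l → l ℚ.≤ s ^ℚ j
  β≤s^[k-1] {s₀} α≤s₀ 0<s₀ j refl {l} Ll = ℚ.≮⇒≥ λ T<l →
    let 0<l = ℚ.<-trans 0<T T<l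
        g , 0<g , Tg≡1 = recip 0<T
        ρ = l ℚ.* g
        1<ρ = subst (ℚ._< ρ) Tg≡1 (*-monoˡ-< 0<g T<l)
        -- W = M + 1 is chosen so large that the extra factor s₀ left by the slack 1/W cannot make
        -- up for the excess ρ^W.
        M , s₀<ρᵂ = powers-unbounded 1<ρ s₀
        s , u , 0<s , Ls , Uu , uᵂ≤sⱽ = power-bound M
        Tρ≡l = trans (ℚ.*-comm T ρ) (pq≡1⇒[xp]q≡x l (trans (ℚ.*-comm g T) Tg≡1))
        lᵂ≤Tᵂs₀ = scaled M 0<s (α≤s₀ s Ls) 0<l (disjoint (real (α *ℝ β)) (lower-* 0<s 0<l Ls Ll) Uu) uᵂ≤sⱽ
        ρᵂ≤s₀ = cancelˡ-≤ (^-pos 0<T (suc M)) (subst (ℚ._≤ T ^ℚ suc M ℚ.* s₀)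
                  (trans (cong (_^ℚ suc M) (sym Tρ≡l)) (^-distrib-* T ρ (suc M))) lᵂ≤Tᵂs₀)
    in ℚ.<-irrefl refl (ℚ.<-≤-trans s₀<ρᵂ ρᵂ≤s₀)
    where
    T = s₀ ^ℚ j
    0<T = ^-pos 0<s₀ j
    scaled : ∀ M {s u} → 0ℚ ℚ.< s → s ℚ.≤ s₀ → 0ℚ ℚ.< l → s ℚ.* l ℚ.< u →
      u ^ℚ suc M ℚ.≤ s ^ℚ suc (suc j ℕ.* suc M) → l ^ℚ suc M ℚ.≤ T ^ℚ suc M ℚ.* s₀
    scaled M {s} {u} 0<s s≤s₀ 0<l sl<u uᵂ≤sⱽ = cancelˡ-≤ (^-pos 0<s W) (begin
      s ^ℚ W ℚ.* l ^ℚ W                  ≡⟨ ^-distrib-* s l W ⟨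
      (s ℚ.* l) ^ℚ W                    ≤⟨ ^-mono-≤ (*-nonNeg 0≤s (ℚ.<⇒≤ 0<l)) (ℚ.<⇒≤ sl<u) W ⟩
      u ^ℚ W                            ≤⟨ uᵂ≤sⱽ ⟩
      s ℚ.* s ^ℚ (W ℕ.+ j ℕ.* W)        ≡⟨ cong (s ℚ.*_) (trans (^-homo-* s W (j ℕ.* W))
                                           (cong (s ^ℚ W ℚ.*_) (sym (^-assocʳ s j W)))) ⟩
      s ℚ.* (s ^ℚ W ℚ.* (s ^ℚ j) ^ℚ W)    ≡⟨ solve 3 (λ s a b → s :* (a :* b) := a :* (b :* s)) refl s (s ^ℚ W) ((s ^ℚ j) ^ℚ W) ⟩
      s ^ℚ W ℚ.* ((s ^ℚ j) ^ℚ W ℚ.* s)    ≤⟨ *-monoʳ-≤ (^-nonNeg 0≤s W) (*-mono-≤ (^-nonNeg (^-nonNeg 0≤s j) W) 0≤s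
                                           (^-mono-≤ (^-nonNeg 0≤s j) (^-mono-≤ 0≤s s≤s₀ j) W) s≤s₀) ⟩
      s ^ℚ W ℚ.* (T ^ℚ W ℚ.* s₀)         ∎)
      where
      open ℚ.≤-Reasoning
      W = suc M
      0≤s = ℚ.<⇒≤ 0<s

-- Integer logarithms to a rational base

pq≡1⇒[xq]p≡x : ∀ {p q} x → p ℚ.* q ≡ 1ℚ → x ℚ.* q ℚ.* p ≡ x
pq≡1⇒[xq]p≡x {p} {q} x pq≡1 = pq≡1⇒[xp]q≡x x (trans (ℚ.*-comm q p) pq≡1)

^-monoʳ-≤ : ∀ {s i j} → 1ℚ ℚ.≤ s → i ℕ.≤ j → s ^ℚ i ℚ.≤ s ^ℚ j
^-monoʳ-≤ {j = j} 1≤s z≤n       = 1≤^ 1≤s j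
^-monoʳ-≤         1≤s (s≤s i≤j) = *-monoʳ-≤ (ℚ.≤-trans (ℚ.<⇒≤ 0<1) 1≤s) (^-monoʳ-≤ 1≤s i≤j)

^-cancelʳ-< : ∀ {s i j} → 1ℚ ℚ.≤ s → s ^ℚ i ℚ.< s ^ℚ j → i ℕ.< j
^-cancelʳ-< 1≤s sⁱ<sʲ = ℕ.≰⇒> λ j≤i → ℚ.<-irrefl refl (ℚ.<-≤-trans sⁱ<sʲ (^-monoʳ-≤ 1≤s j≤i))

-- Descent from an exponent that is too large to the first power not exceeding x; s^0 = 1 ≤ x stops
-- it.
⌊log⌋-below : ∀ {s x} n → 1ℚ ℚ.≤ x → x ℚ.< s ^ℚ n → ∃[ l ] s ^ℚ l ℚ.≤ x × x ℚ.< s ^ℚ suc l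
⌊log⌋-below zero 1≤x x<1 = contradiction (ℚ.≤-<-trans 1≤x x<1) (ℚ.<-irrefl refl)
⌊log⌋-below {s} {x} (suc n) 1≤x x<sⁿ⁺¹ with s ^ℚ n ℚ.≤? x
... | yes sⁿ≤x = n , sⁿ≤x , x<sⁿ⁺¹
... | no  sⁿ≰x = ⌊log⌋-below n 1≤x (ℚ.≰⇒> sⁿ≰x)

⌊log⌋ : ∀ {s x} → 1ℚ ℚ.< s → 1ℚ ℚ.≤ x → ∃[ l ] s ^ℚ l ℚ.≤ x × x ℚ.< s ^ℚ suc l
⌊log⌋ {x = x} 1<s 1≤x = let n , x<sⁿ = powers-unbounded 1<s x in ⌊log⌋-below (suc n) 1≤x x<sⁿ

-- Compare exponents in s^(i+1) ≤ xs ≤ y < s^(j+1).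
⌊log⌋-increases : ∀ {s x y i j} → 1ℚ ℚ.< s → x ℚ.* s ℚ.≤ y → s ^ℚ i ℚ.≤ x → y ℚ.< s ^ℚ suc j → i ℕ.< j
⌊log⌋-increases {s} {i = i} 1<s xs≤y sⁱ≤x y<sʲ⁺¹ = ℕ.s≤s⁻¹ (^-cancelʳ-< (ℚ.<⇒≤ 1<s) (ℚ.≤-<-trans
  (ℚ.≤-trans (ℚ.≤-reflexive (ℚ.*-comm s (s ^ℚ i))) (*-monoˡ-≤ (ℚ.<⇒≤ (ℚ.<-trans 0<1 1<s)) sⁱ≤x))
  (ℚ.≤-<-trans xs≤y y<sʲ⁺¹)))

-- The hypothesis on y is y ≤ s^(k-1) x, multiplied by s to avoid the exponent k-1. Compare
-- exponents in s^(j+1) ≤ ys ≤ s^k x < s^(k+i+1).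
⌊log⌋-bounded : ∀ {s x y i j k} → 1ℚ ℚ.< s → y ℚ.* s ℚ.≤ s ^ℚ k ℚ.* x → x ℚ.< s ^ℚ suc i → s ^ℚ j ℚ.≤ y → j ℕ.< i ℕ.+ k
⌊log⌋-bounded {s} {x} {y} {i} {j} {k} 1<s ys≤sᵏx x<sⁱ⁺¹ sʲ≤y = ℕ.s≤s⁻¹ (^-cancelʳ-< (ℚ.<⇒≤ 1<s) (begin-strict
  s ℚ.* s ^ℚ j          ≡⟨ ℚ.*-comm s (s ^ℚ j) ⟩
  s ^ℚ j ℚ.* s          ≤⟨ *-monoˡ-≤ (ℚ.<⇒≤ 0<s) sʲ≤y ⟩
  y ℚ.* s              ≤⟨ ys≤sᵏx ⟩
  s ^ℚ k ℚ.* x          <⟨ *-monoʳ-< (^-pos 0<s k) x<sⁱ⁺¹ ⟩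
  s ^ℚ k ℚ.* s ^ℚ suc i  ≡⟨ ^-homo-* s k (suc i) ⟨
  s ^ℚ (k ℕ.+ suc i)    ≡⟨ cong (s ^ℚ_) (ℕ.+-comm k (suc i)) ⟩
  s ^ℚ suc (i ℕ.+ k)    ∎))
  where
  open ℚ.≤-Reasoning
  0<s = ℚ.<-trans 0<1 1<s

1≤ι-value : ∀ n → 1ℚ ℚ.≤ ι (+ ℕ₊.value n)
1≤ι-value (mk (suc n)) = 1≤ι-suc n

-- The alternatives are the interval from s to s^(k-1) and its reciprocal, freed of division. In the
-- second, n is the larger vertex and `distinct` is used with the roles exchanged.
log-colourable : ∀ {S s k} .{{_ : NonZero k}} → 1ℚ ℚ.< s →
  (∀ r → member S r → (s ℚ.≤ r × r ℚ.* s ℚ.≤ s ^ℚ k) ⊎ (r ℚ.* s ℚ.≤ 1ℚ × s ℚ.≤ s ^ℚ k ℚ.* r)) →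
  Colourable G[ S ] k
log-colourable {S} {s} {k} 1<s intervals = colourable {S} (λ n → level n mod k) λ m n m/n∈S →
  Sum.[ (λ (s≤r , rs≤sᵏ) → distinct n m
          (subst₂ ℚ._≤_ (ℚ.*-comm s (x n)) (ratio-* m n) (*-monoˡ-≤ (0≤x n) s≤r))
          (subst (ℚ._≤ s ^ℚ k ℚ.* x n) (trans (swap (ratio m n) s (x n)) (cong (ℚ._* s) (ratio-* m n)))
            (*-monoˡ-≤ (0≤x n) rs≤sᵏ)))
      , (λ (rs≤1 , s≤sᵏr) → ≢-sym (distinct m n
          (subst₂ ℚ._≤_ (trans (swap (ratio m n) s (x n)) (cong (ℚ._* s) (ratio-* m n)))
            (ℚ.*-identityˡ (x n)) (*-monoˡ-≤ (0≤x n) rs≤1))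
          (subst₂ ℚ._≤_ (ℚ.*-comm s (x n))
            (trans (ℚ.*-assoc (s ^ℚ k) (ratio m n) (x n)) (cong (s ^ℚ k ℚ.*_) (ratio-* m n)))
            (*-monoˡ-≤ (0≤x n) s≤sᵏr))))
      ]′ (intervals (ratio m n) m/n∈S)
  where
  x : ℕ₊ → ℚ
  x n = ι (+ ℕ₊.value n)
  0≤x : ∀ n → 0ℚ ℚ.≤ x n
  0≤x n = ι-nonNeg (ℕ₊.value n)
  level : ℕ₊ → ℕ
  level n = proj₁ (⌊log⌋ 1<s (1≤ι-value n))
  swap : ∀ r s x → r ℚ.* s ℚ.* x ≡ r ℚ.* x ℚ.* s
  swap = solve 3 (λ r s x → r :* s :* x := r :* x :* s) refl
  distinct : ∀ n m → x n ℚ.* s ℚ.≤ x m → x m ℚ.* s ℚ.≤ s ^ℚ k ℚ.* x n → level m mod k ≢ level n mod k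
  distinct n m xₙs≤xₘ xₘs≤sᵏxₙ =
    let sⁱ≤xₙ , xₙ<sⁱ⁺¹ = proj₂ (⌊log⌋ 1<s (1≤ι-value n))
        sʲ≤xₘ , xₘ<sʲ⁺¹ = proj₂ (⌊log⌋ 1<s (1≤ι-value m))
    in mod-distinct (level m) (level n) k (⌊log⌋-increases 1<s xₙs≤xₘ sⁱ≤xₙ xₘ<sʲ⁺¹)
         (⌊log⌋-bounded {k = k} 1<s xₘs≤sᵏxₙ xₙ<sⁱ⁺¹ sʲ≤xₘ)

-- Infima of linear fractional sequences

ι-mono-≤ : ∀ {m n} → m ℕ.≤ n → ι (+ m) ℚ.≤ ι (+ n)
ι-mono-≤ {m} {n} m≤n with ℕ.m≤n⇒m<n∨m≡n m≤n
... | inj₁ m<n  = ℚ.<⇒≤ (ι-mono-< (ℤ.+<+ m<n))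
... | inj₂ refl = ℚ.≤-refl

eventually-positive : ∀ {e} → 0ℚ ℚ.< e → ∀ f → ∃[ N ] (∀ n → N ℕ.≤ n → 0ℚ ℚ.< e ℚ.* ι (+ n) ℚ.+ f)
eventually-positive {e} 0<e f with recip 0<e
... | h , 0<h , eh≡1 with archimedean (ℚ.- f ℚ.* h)
... | N , -fh<1+N = suc N , λ n N<n → begin-strict
  0ℚ                               ≡⟨ ℚ.+-inverseˡ f ⟨
  ℚ.- f ℚ.+ f                      ≡⟨ cong (ℚ._+ f) (pq≡1⇒[xq]p≡x (ℚ.- f) eh≡1) ⟨
  ℚ.- f ℚ.* h ℚ.* e ℚ.+ f          <⟨ ℚ.+-monoˡ-< f (*-monoˡ-< 0<e -fh<1+N) ⟩
  ι (+ suc N) ℚ.* e ℚ.+ f          ≤⟨ ℚ.+-monoˡ-≤ f (*-monoˡ-≤ (ℚ.<⇒≤ 0<e) (ι-mono-≤ N<n)) ⟩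
  ι (+ n) ℚ.* e ℚ.+ f              ≡⟨ cong (ℚ._+ f) (ℚ.*-comm (ι (+ n)) e) ⟩
  e ℚ.* ι (+ n) ℚ.+ f              ∎
  where
  open ℚ.≤-Reasoning

-- The infimum of the quotients X n / Y n for n ≥ N, all of them above 1. Denominators are cleared
-- so that no proof of Y n ≢ 0 enters the terms.
IsInfimumFrom : ℕ → (X Y : ℕ → ℚ) → ℚ → Set
IsInfimumFrom N X Y s =
  (∀ n → N ℕ.≤ n → 0ℚ ℚ.< Y n × Y n ℚ.< X n × s ℚ.* Y n ℚ.≤ X n) ×
  (∀ t → (∀ n → N ℕ.≤ n → t ℚ.* Y n ℚ.≤ X n) → t ℚ.≤ s)

isInfimumFrom-resp-≗ : ∀ {N X X′ Y Y′ s} → (∀ n → X n ≡ X′ n) → (∀ n → Y n ≡ Y′ n) →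
  IsInfimumFrom N X Y s → IsInfimumFrom N X′ Y′ s
isInfimumFrom-resp-≗ {X = X} {X′} {Y} {Y′} {s} X≗X′ Y≗Y′ (bounds , greatest) =
  (λ n N≤n → bounds-resp {X n} {X′ n} {Y n} {Y′ n} (X≗X′ n) (Y≗Y′ n) (bounds n N≤n)) ,
  (λ t tY′≤X′ → greatest t λ n N≤n → *≤-resp {t} {X′ n} {X n} {Y′ n} {Y n} (sym (X≗X′ n)) (sym (Y≗Y′ n)) (tY′≤X′ n N≤n))
  where
  bounds-resp : ∀ {x x′ y y′} → x ≡ x′ → y ≡ y′ →
    0ℚ ℚ.< y × y ℚ.< x × s ℚ.* y ℚ.≤ x → 0ℚ ℚ.< y′ × y′ ℚ.< x′ × s ℚ.* y′ ℚ.≤ x′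
  bounds-resp refl refl bounds = bounds
  *≤-resp : ∀ {t x x′ y y′} → x ≡ x′ → y ≡ y′ → t ℚ.* y ℚ.≤ x → t ℚ.* y′ ℚ.≤ x′
  *≤-resp refl refl ty≤x = ty≤x

-- The quotients (an+b)/(cn+d) with n ≥ N are monotone in n and tend to a/c, so
-- their infimum s is a/c or the first of them.
module Tail {a c : ℚ} (b d : ℚ) (0<c : 0ℚ ℚ.< c) (c<a : c ℚ.< a) where

  X Y : ℕ → ℚ
  X n = a ℚ.* ι (+ n) ℚ.+ b
  Y n = c ℚ.* ι (+ n) ℚ.+ d

  Y<X : ∀ ν → 0ℚ ℚ.< (a ℚ.- c) ℚ.* ν ℚ.+ (b ℚ.- d) → c ℚ.* ν ℚ.+ d ℚ.< a ℚ.* ν ℚ.+ b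
  Y<X ν 0<X-Y = <-by _ 0<X-Y (solve 5 (λ a b c d n →
    a :* n :+ b := (c :* n :+ d) :+ ((a :- c) :* n :+ (b :- d))) refl a b c d ν)

  X<tY : ∀ t ν → 0ℚ ℚ.< (t ℚ.* c ℚ.- a) ℚ.* ν ℚ.+ (t ℚ.* d ℚ.- b) → a ℚ.* ν ℚ.+ b ℚ.< t ℚ.* (c ℚ.* ν ℚ.+ d)
  X<tY t ν 0<tY-X = <-by _ 0<tY-X (solve 6 (λ a b c d n t →
    t :* (c :* n :+ d) := (a :* n :+ b) :+ ((t :* c :- a) :* n :+ (t :* d :- b))) refl a b c d ν t)

  -- Since cX - aY = bc - ad, the condition ad ≤ bc keeps the quotients above their limit a/c, where
  -- g = 1/c.
  a/c≤X/Y : ∀ {g} ν → 0ℚ ℚ.< g → c ℚ.* g ≡ 1ℚ → a ℚ.* d ℚ.≤ b ℚ.* c → a ℚ.* g ℚ.* (c ℚ.* ν ℚ.+ d) ℚ.≤ a ℚ.* ν ℚ.+ b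
  a/c≤X/Y {g} ν 0<g cg≡1 ad≤bc = begin
      a ℚ.* g ℚ.* (c ℚ.* ν ℚ.+ d)                    ≡⟨ solve 5 (λ a c d g n →
                                                        a :* g :* (c :* n :+ d) := a :* n :* (c :* g) :+ a :* d :* g) refl a c d g ν ⟩
      a ℚ.* ν ℚ.* (c ℚ.* g) ℚ.+ a ℚ.* d ℚ.* g        ≤⟨ ℚ.+-monoʳ-≤ (a ℚ.* ν ℚ.* (c ℚ.* g)) (*-monoˡ-≤ (ℚ.<⇒≤ 0<g) ad≤bc) ⟩
      a ℚ.* ν ℚ.* (c ℚ.* g) ℚ.+ b ℚ.* c ℚ.* g        ≡⟨ solve 5 (λ a b c g n →
                                                        a :* n :* (c :* g) :+ b :* c :* g := (a :* n :+ b) :* (c :* g)) refl a b c g ν ⟩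
      (a ℚ.* ν ℚ.+ b) ℚ.* (c ℚ.* g)                  ≡⟨ cong ((a ℚ.* ν ℚ.+ b) ℚ.*_) cg≡1 ⟩
      (a ℚ.* ν ℚ.+ b) ℚ.* 1ℚ                         ≡⟨ ℚ.*-identityʳ (a ℚ.* ν ℚ.+ b) ⟩
      a ℚ.* ν ℚ.+ b                                  ∎
      where open ℚ.≤-Reasoning

  -- Since Xν Y₀ - X₀ Yν = (ad - bc)(ν - μ), the condition bc ≤ ad makes the quotients increase from
  -- the one at μ.
  X₀/Y₀≤X/Y : ∀ {g} μ ν → 0ℚ ℚ.< g → (c ℚ.* μ ℚ.+ d) ℚ.* g ≡ 1ℚ → b ℚ.* c ℚ.≤ a ℚ.* d → μ ℚ.≤ ν →
    (a ℚ.* μ ℚ.+ b) ℚ.* g ℚ.* (c ℚ.* ν ℚ.+ d) ℚ.≤ a ℚ.* ν ℚ.+ b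
  X₀/Y₀≤X/Y {g} μ ν 0<g Y₀g≡1 bc≤ad μ≤ν = begin
      X₀ ℚ.* g ℚ.* Yν            ≡⟨ solve 3 (λ x g y → x :* g :* y := x :* y :* g) refl X₀ g Yν ⟩
      X₀ ℚ.* Yν ℚ.* g            ≤⟨ *-monoˡ-≤ (ℚ.<⇒≤ 0<g) cross-≤ ⟩
      Xν ℚ.* Y₀ ℚ.* g            ≡⟨ pq≡1⇒[xp]q≡x Xν Y₀g≡1 ⟩
      Xν                         ∎
      where
      open ℚ.≤-Reasoning
      X₀ = a ℚ.* μ ℚ.+ b
      Y₀ = c ℚ.* μ ℚ.+ d
      Xν = a ℚ.* ν ℚ.+ b
      Yν = c ℚ.* ν ℚ.+ d
      cross : Xν ℚ.* Y₀ ≡ X₀ ℚ.* Yν ℚ.+ (a ℚ.* d ℚ.- b ℚ.* c) ℚ.* (ν ℚ.- μ)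
      cross = solve 6 (λ a b c d m n →
        (a :* n :+ b) :* (c :* m :+ d) := (a :* m :+ b) :* (c :* n :+ d) :+ (a :* d :- b :* c) :* (n :- m)) refl a b c d μ ν
      cross-≤ : X₀ ℚ.* Yν ℚ.≤ Xν ℚ.* Y₀
      cross-≤ = ≤-by ((a ℚ.* d ℚ.- b ℚ.* c) ℚ.* (ν ℚ.- μ)) (*-nonNeg (0≤q-p bc≤ad) (0≤q-p μ≤ν)) cross

  -- For t > a/c the affine function tY - X has the positive slope tc - a, so tY ≤ X fails for large
  -- n.
  a/c-infimum : ∀ {g} N → c ℚ.* g ≡ 1ℚ → ∀ t → (∀ n → N ℕ.≤ n → t ℚ.* Y n ℚ.≤ X n) → t ℚ.≤ a ℚ.* g
  a/c-infimum {g} N cg≡1 t tY≤X = ℚ.≮⇒≥ λ s<t →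
    let a<tc = subst (ℚ._< t ℚ.* c) (pq≡1⇒[xq]p≡x a cg≡1) (*-monoˡ-< 0<c s<t)
        M , 0<tY-X = eventually-positive (0<q-p a<tc) (t ℚ.* d ℚ.- b)
        n = N ℕ.+ M
    in ℚ.<-irrefl refl (ℚ.<-≤-trans (X<tY t (ι (+ n)) (0<tY-X n (ℕ.m≤n+m M N))) (tY≤X n (ℕ.m≤m+n N M)))

  -- Starting at `suc N` keeps all indices positive, as the definition of `R` demands.
  infimum : ∃[ N ] ∃[ s ] IsInfimumFrom (suc N) X Y s
  infimum =
    let N₁ , 0<Y = eventually-positive 0<c d
        N₂ , 0<X-Y = eventually-positive (0<q-p c<a) (b ℚ.- d)
        N = N₁ ℕ.+ N₂
        s , s-infimum = infimumFrom (suc N)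
          (λ n N<n → 0<Y n (ℕ.m+n≤o⇒m≤o N₁ (ℕ.<⇒≤ N<n)))
          (λ n N<n → Y<X (ι (+ n)) (0<X-Y n (ℕ.m+n≤o⇒n≤o N₁ (ℕ.<⇒≤ N<n))))
    in N , s , s-infimum
    where
    infimumFrom : ∀ N → (∀ n → N ℕ.≤ n → 0ℚ ℚ.< Y n) → (∀ n → N ℕ.≤ n → Y n ℚ.< X n) → ∃[ s ] IsInfimumFrom N X Y s
    infimumFrom N 0<Y Y<X with ℚ.≤-total (a ℚ.* d) (b ℚ.* c)
    ... | inj₁ ad≤bc =
      let g , 0<g , cg≡1 = recip 0<c
      in a ℚ.* g , (λ n N≤n → 0<Y n N≤n , Y<X n N≤n , a/c≤X/Y (ι (+ n)) 0<g cg≡1 ad≤bc) , a/c-infimum N cg≡1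
    ... | inj₂ bc≤ad =
      let g , 0<g , Y₀g≡1 = recip (0<Y N ℕ.≤-refl)
      in X N ℚ.* g ,
         (λ n N≤n → 0<Y n N≤n , Y<X n N≤n , X₀/Y₀≤X/Y (ι (+ N)) (ι (+ n)) 0<g Y₀g≡1 bc≤ad (ι-mono-≤ N≤n)) ,
         (λ t tY≤X → subst (ℚ._≤ X N ℚ.* g) (pq≡1⇒[xp]q≡x t Y₀g≡1) (*-monoˡ-≤ (ℚ.<⇒≤ 0<g) (tY≤X N ℕ.≤-refl)))

-- Ratios separated by α and β

1<*1< : ∀ {p q} → 1ℚ ℚ.< p → 1ℚ ℚ.< q → 1ℚ ℚ.< p ℚ.* q
1<*1< {p} {q} 1<p 1<q = ℚ.<-trans 1<p (subst (ℚ._< p ℚ.* q) (ℚ.*-identityʳ p) (*-monoʳ-< (ℚ.<-trans 0<1 1<p) 1<q))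

module Quotient {r X Y : ℚ} (0<Y : 0ℚ ℚ.< Y) (rY≡X : r ℚ.* Y ≡ X) where

  rtY≡tX : ∀ t → r ℚ.* t ℚ.* Y ≡ t ℚ.* X
  rtY≡tX t = trans (solve 3 (λ t r y → r :* t :* y := t :* (r :* y)) refl t r Y) (cong (t ℚ.*_) rY≡X)

  sY≤X⇒s≤r : ∀ {s} → s ℚ.* Y ℚ.≤ X → s ℚ.≤ r
  sY≤X⇒s≤r {s} sY≤X = cancelʳ-≤ 0<Y (subst (s ℚ.* Y ℚ.≤_) (sym rY≡X) sY≤X)

  sX≤Y⇒rs≤1 : ∀ {s} → s ℚ.* X ℚ.≤ Y → r ℚ.* s ℚ.≤ 1ℚ
  sX≤Y⇒rs≤1 {s} sX≤Y = cancelʳ-≤ 0<Y (subst₂ ℚ._≤_ (sym (rtY≡tX s)) (sym (ℚ.*-identityˡ Y)) sX≤Y)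

  t<r⇒tY≤X : ∀ {t} → t ℚ.< r → t ℚ.* Y ℚ.≤ X
  t<r⇒tY≤X {t} t<r = subst (t ℚ.* Y ℚ.≤_) rY≡X (*-monoˡ-≤ (ℚ.<⇒≤ 0<Y) (ℚ.<⇒≤ t<r))

  tr<1⇒tX≤Y : ∀ {t} → t ℚ.* r ℚ.< 1ℚ → t ℚ.* X ℚ.≤ Y
  tr<1⇒tX≤Y {t} tr<1 = subst₂ ℚ._≤_ (trans (cong (ℚ._* Y) (ℚ.*-comm t r)) (rtY≡tX t)) (ℚ.*-identityˡ Y)
    (*-monoˡ-≤ (ℚ.<⇒≤ 0<Y) (ℚ.<⇒≤ tr<1))

  Y<X⇒1<r : Y ℚ.< X → 1ℚ ℚ.< r
  Y<X⇒1<r Y<X = cancelʳ-< 0<Y (subst₂ ℚ._<_ (sym (ℚ.*-identityˡ Y)) (sym rY≡X) Y<X)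

  X<Y⇒r<1 : X ℚ.< Y → r ℚ.< 1ℚ
  X<Y⇒r<1 X<Y = cancelʳ-< 0<Y (subst₂ ℚ._<_ (sym rY≡X) (sym (ℚ.*-identityˡ Y)) X<Y)

below-if : ∀ (x : ℝ) {r} → x <ℝ fromℚ r → ∀ t → lower x t → t ℚ.< r
below-if x (q , Uq , q<r) t Lt = ℚ.<-trans (disjoint x Lt Uq) q<r

<⁻¹⇒*<1 : ∀ (x : ℝ⁺) {r} → 0ℚ ℚ.< r → fromℚ r <ℝ real (x ⁻¹) → ∀ t → lower (real x) t → t ℚ.* r ℚ.< 1ℚ
<⁻¹⇒*<1 x {r} 0<r (q , r<q , q′ , q<q′ , u , Uu , q′u≤1) t Lt = begin-strict
  t ℚ.* r       <⟨ *-monoˡ-< 0<r (disjoint (real x) Lt Uu) ⟩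
  u ℚ.* r       <⟨ *-monoʳ-< (upper-positive x Uu) (ℚ.<-trans r<q q<q′) ⟩
  u ℚ.* q′      ≡⟨ ℚ.*-comm u q′ ⟩
  q′ ℚ.* u      ≤⟨ q′u≤1 ⟩
  1ℚ            ∎
  where open ℚ.≤-Reasoning

⁻¹<⇒1≤* : ∀ (x : ℝ⁺) {r} → real (x ⁻¹) <ℝ fromℚ r → ∃[ l ] lower (real x) l × 1ℚ ℚ.≤ r ℚ.* l
⁻¹<⇒1≤* x {r} (q , (r′ , r′<q , l , 0<l , Ll , 1≤r′l) , q<r) =
  l , Ll , ℚ.≤-trans 1≤r′l (ℚ.<⇒≤ (*-monoˡ-< 0<l (ℚ.<-trans r′<q q<r)))

module SeparatedRatios {a c : ℕ} (0<a : 0ℚ ℚ.< ι (+ a)) (0<c : 0ℚ ℚ.< ι (+ c)) (b d : ℤ) (α β : ℝ⁺) (1<α : 1ℝ <ℝ real α)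
  (separation : ∀ r → member (R a b c d) r → r ∈⟨ real (β ⁻¹) , real (α ⁻¹) ⟩ ⊎ r ∈⟨ real α , real β ⟩) where

  Numerator Denominator : ℕ → ℚ
  Numerator n   = ι (+ a ℤ.* + n ℤ.+ b)
  Denominator n = ι (+ c ℤ.* + n ℤ.+ d)

  ValueAt : ℕ → ℚ → Set
  ValueAt n r = ∃[ D≢0 ] r ≡ (Numerator n ÷ Denominator n) {{D≢0}}

  valueAt⇒* : ∀ n {r} → ValueAt n r → r ℚ.* Denominator n ≡ Numerator n
  valueAt⇒* n (D≢0 , refl) = ÷-* (Numerator n) (Denominator n) {{D≢0}}

  -- α ≤ s for a rational s, expressed through the cut of α.
  Below : ℚ → Set
  Below s = ∀ t → lower (real α) t → t ℚ.≤ s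

  -- For positive s and r: r lies outside the open interval (1/s, s).
  Covers : ℚ → ℚ → Set
  Covers s r = s ℚ.≤ r ⊎ r ℚ.* s ℚ.≤ 1ℚ

  covers-antitone : ∀ {s s′ r} → 0ℚ ℚ.< r → s′ ℚ.≤ s → Covers s r → Covers s′ r
  covers-antitone 0<r s′≤s = Sum.map (ℚ.≤-trans s′≤s) (ℚ.≤-trans (*-monoʳ-≤ (ℚ.<⇒≤ 0<r) s′≤s))

  separated : ∀ {r} → member (R a b c d) r →
    ((∀ t → lower (real α) t → t ℚ.< r) × ∃[ l ] lower (real β) l × r ℚ.≤ l) ⊎
    ((∀ t → lower (real α) t → t ℚ.* r ℚ.< 1ℚ) × ∃[ l ] lower (real β) l × 1ℚ ℚ.≤ r ℚ.* l)
  separated {r} r∈R with separation r r∈R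
  ... | inj₂ (α<r , q , r<q , Lq) = inj₁ (below-if (real α) α<r , q , Lq , ℚ.<⇒≤ r<q)
  ... | inj₁ (β⁻¹<r , r<α⁻¹) = inj₂ (<⁻¹⇒*<1 α (member-pos (R a b c d) r∈R) r<α⁻¹ , ⁻¹<⇒1≤* β β⁻¹<r)

  -- As α > 1, the interval (β⁻¹, α⁻¹) lies below 1, so r is in the other one.
  >1⇒above : ∀ {r} → 1ℚ ℚ.< r → member (R a b c d) r → ∀ t → lower (real α) t → t ℚ.< r
  >1⇒above {r} 1<r r∈R with separated r∈R
  ... | inj₁ (α<r , _) = α<r
  ... | inj₂ (αr<1 , _) = let t , 1<t , Lt = 1<α in contradiction
    (ℚ.<-trans (1<*1< 1<t 1<r) (αr<1 t Lt)) (ℚ.<-irrefl refl)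

  <1⇒below : ∀ {r} → r ℚ.< 1ℚ → member (R a b c d) r → ∀ t → lower (real α) t → t ℚ.* r ℚ.< 1ℚ
  <1⇒below {r} r<1 r∈R with separated r∈R
  ... | inj₁ (α<r , _) = let t , 1<t , Lt = 1<α in contradiction
    (ℚ.<-trans 1<t (ℚ.<-trans (α<r t Lt) r<1)) (ℚ.<-irrefl refl)
  ... | inj₂ (αr<1 , _) = αr<1

  CoversFrom : ℕ → ℚ → Set
  CoversFrom N s = ∀ n → N ℕ.≤ n → ∀ r → ValueAt n r → 0ℚ ℚ.< r → r ≢ 1ℚ → Covers s r

  -- Replace s by its minimum with r or 1/r, whichever is above α, so α remains at most the new s.
  cover : ∀ {s r} → Below s → member (R a b c d) r → ∃[ s′ ] s′ ℚ.≤ s × Below s′ × Covers s′ r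
  cover {s} {r} α≤s r∈R with separated r∈R
  ... | inj₁ (α<r , _) = s ℚ.⊓ r , ℚ.p⊓q≤p s r , (λ t Lt → ℚ.⊓-glb (α≤s t Lt) (ℚ.<⇒≤ (α<r t Lt))) , inj₁ (ℚ.p⊓q≤q s r)
  ... | inj₂ (αr<1 , _) with recip (member-pos (R a b c d) r∈R)
  ...   | h , 0<h , rh≡1 = s ℚ.⊓ h , ℚ.p⊓q≤p s h ,
    (λ t Lt → ℚ.⊓-glb (α≤s t Lt) (subst₂ ℚ._≤_ (pq≡1⇒[xp]q≡x t rh≡1) (ℚ.*-identityˡ h)
      (*-monoˡ-≤ (ℚ.<⇒≤ 0<h) (ℚ.<⇒≤ (αr<1 t Lt))))) ,
    inj₂ (ℚ.≤-trans (*-monoʳ-≤ (ℚ.<⇒≤ (member-pos (R a b c d) r∈R)) (ℚ.p⊓q≤q s h)) (ℚ.≤-reflexive rh≡1))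

  -- An index has at most one value. If it is undefined, not positive or 1, there is nothing to
  -- cover and s stays; otherwise it is a member and `cover` applies.
  cover-value : ∀ {s} n → Below s → ∃[ s′ ] s′ ℚ.≤ s × Below s′ ×
        (∀ r → ValueAt (suc n) r → 0ℚ ℚ.< r → r ≢ 1ℚ → Covers s′ r)
  cover-value {s} n α≤s with Denominator (suc n) ℚ.≟ 0ℚ
  ... | yes D≡0 = s , ℚ.≤-refl , α≤s , λ r (D≢0 , _) → ⊥-elim (ℕ.NonZero.nonZero (subst ℚ.NonZero D≡0 D≢0))
  ... | no  D≢0 = decide _ refl
    where
    decide : ∀ r → r ≡ (Numerator (suc n) ÷ Denominator (suc n)) {{ℚ.≢-nonZero D≢0}} →
      ∃[ s′ ] s′ ℚ.≤ s × Below s′ ×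
        (∀ r → ValueAt (suc n) r → 0ℚ ℚ.< r → r ≢ 1ℚ → Covers s′ r)
    decide r r≡ with 0ℚ ℚ.<? r | r ℚ.≟ 1ℚ
    ... | no 0≮r | _ = s , ℚ.≤-refl , α≤s , λ r′ (_ , r′≡) 0<r′ _ →
      contradiction (subst (0ℚ ℚ.<_) (trans r′≡ (sym r≡)) 0<r′) 0≮r
    ... | yes _ | yes r≡1 = s , ℚ.≤-refl , α≤s , λ r′ (_ , r′≡) _ r′≢1 →
      contradiction (trans (trans r′≡ (sym r≡)) r≡1) r′≢1
    ... | yes 0<r | no r≢1 =
      let s′ , s′≤s , α≤s′ , s′-covers = cover α≤s ((mk (suc n) , ℚ.≢-nonZero D≢0 , r≡) , 0<r , r≢1)
      in s′ , s′≤s , α≤s′ , λ r′ (_ , r′≡) _ _ → subst (Covers s′) (trans r≡ (sym r′≡)) s′-covers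

  -- The finitely many indices before the tail are absorbed one at a time, downwards to 1. Each step
  -- may lower s, which preserves what was covered already.
  extend : ∀ N {s} → Below s → CoversFrom (suc N) s → ∃[ s′ ] Below s′ × CoversFrom 1 s′
  extend zero    {s} α≤s s-covers = s , α≤s , s-covers
  extend (suc N) {s} α≤s s-covers with cover-value N α≤s
  ... | s′ , s′≤s , α≤s′ , s′-covers = extend N α≤s′ λ n N<n r r-value 0<r r≢1 →
    Sum.[ (λ 1+N<n → covers-antitone 0<r s′≤s (s-covers n 1+N<n r r-value 0<r r≢1))
        , (λ where refl → s′-covers r r-value 0<r r≢1)
        ]′ (ℕ.m≤n⇒m<n∨m≡n N<n)

  numerator≡ : ∀ n → Numerator n ≡ ι (+ a) ℚ.* ι (+ n) ℚ.+ ι b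
  numerator≡ n = trans (ι-+ (+ a ℤ.* + n) b) (cong (ℚ._+ ι b) (ι-* (+ a) (+ n)))

  denominator≡ : ∀ n → Denominator n ≡ ι (+ c) ℚ.* ι (+ n) ℚ.+ ι d
  denominator≡ n = trans (ι-+ (+ c ℤ.* + n) d) (cong (ℚ._+ ι d) (ι-* (+ c) (+ n)))

  value : ∀ n .{{_ : NonZero n}} → 0ℚ ℚ.< Numerator n → 0ℚ ℚ.< Denominator n → Numerator n ≢ Denominator n →
    ∃[ r ] member (R a b c d) r × r ℚ.* Denominator n ≡ Numerator n
  value n 0<X 0<Y X≢Y with recip 0<Y
  ... | g , 0<g , Yg≡1 = Numerator n ℚ.* g , equation⇒member {a} {b} {c} {d} (mk n) 0<X 0<Y X≢Y [Xg]Y≡X , [Xg]Y≡X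
    where
    [Xg]Y≡X : Numerator n ℚ.* g ℚ.* Denominator n ≡ Numerator n
    [Xg]Y≡X = pq≡1⇒[xq]p≡x {Denominator n} {g} (Numerator n) Yg≡1

  module TailAbove (N : ℕ) (s : ℚ) (s-infimum : IsInfimumFrom (suc N) Numerator Denominator s) where

    covers : CoversFrom (suc N) s
    covers n N<n r r-value _ _ =
      let 0<Y , _ , sY≤X = proj₁ s-infimum n N<n
      in inj₁ (Quotient.sY≤X⇒s≤r {r} {Numerator n} {Denominator n} 0<Y (valueAt⇒* n r-value) {s} sY≤X)

    -- Each quotient in the tail is a member above 1, hence above every rational t < α. As s is the
    -- greatest lower bound of these quotients, t ≤ s.
    below : Below s
    below t Lt = proj₂ s-infimum t tY≤X
      where
      tY≤X : ∀ n → suc N ℕ.≤ n → t ℚ.* Denominator n ℚ.≤ Numerator n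
      tY≤X n@(suc _) N<n =
        let 0<Y , Y<X , _ = proj₁ s-infimum n N<n
            0<X = ℚ.<-trans {0ℚ} {Denominator n} {Numerator n} 0<Y Y<X
            r , r∈R , rY≡X = value n 0<X 0<Y (≢-sym (ℚ.<⇒≢ {Denominator n} {Numerator n} Y<X))
            1<r = Quotient.Y<X⇒1<r {r} {Numerator n} {Denominator n} 0<Y rY≡X Y<X
        in Quotient.t<r⇒tY≤X {r} {Numerator n} {Denominator n} 0<Y rY≡X {t} (>1⇒above {r} 1<r r∈R t Lt)

  -- The mirror image for a < c: here s is the infimum of the reciprocals, so the tail lies below
  -- 1/s.
  module TailBelow (N : ℕ) (s : ℚ) (s-infimum : IsInfimumFrom (suc N) Denominator Numerator s) where

    covers : CoversFrom (suc N) s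
    covers n N<n r r-value _ _ =
      let 0<X , X<Y , sX≤Y = proj₁ s-infimum n N<n
          0<Y = ℚ.<-trans {0ℚ} {Numerator n} {Denominator n} 0<X X<Y
      in inj₂ (Quotient.sX≤Y⇒rs≤1 {r} {Numerator n} {Denominator n} 0<Y (valueAt⇒* n r-value) {s} sX≤Y)

    below : Below s
    below t Lt = proj₂ s-infimum t tX≤Y
      where
      tX≤Y : ∀ n → suc N ℕ.≤ n → t ℚ.* Numerator n ℚ.≤ Denominator n
      tX≤Y n@(suc _) N<n =
        let 0<X , X<Y , _ = proj₁ s-infimum n N<n
            0<Y = ℚ.<-trans {0ℚ} {Numerator n} {Denominator n} 0<X X<Y
            r , r∈R , rY≡X = value n 0<X 0<Y (ℚ.<⇒≢ {Numerator n} {Denominator n} X<Y)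
            r<1 = Quotient.X<Y⇒r<1 {r} {Numerator n} {Denominator n} 0<Y rY≡X X<Y
        in Quotient.tr<1⇒tX≤Y {r} {Numerator n} {Denominator n} 0<Y rY≡X {t} (<1⇒below {r} r<1 r∈R t Lt)

  tail-above : ι (+ c) ℚ.< ι (+ a) → ∃[ N ] ∃[ s ] Below s × CoversFrom (suc N) s
  tail-above c<a =
    let N , s , infimum = Tail.infimum (ι b) (ι d) 0<c c<a
        s-infimum = isInfimumFrom-resp-≗ {suc N} {X′ = Numerator} {Y′ = Denominator} {s}
                      (λ n → sym (numerator≡ n)) (λ n → sym (denominator≡ n)) infimum
    in N , s , TailAbove.below N s s-infimum , TailAbove.covers N s s-infimum

  tail-below : ι (+ a) ℚ.< ι (+ c) → ∃[ N ] ∃[ s ] Below s × CoversFrom (suc N) s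
  tail-below a<c =
    let N , s , infimum = Tail.infimum (ι d) (ι b) 0<a a<c
        s-infimum = isInfimumFrom-resp-≗ {suc N} {X′ = Denominator} {Y′ = Numerator} {s}
                      (λ n → sym (denominator≡ n)) (λ n → sym (numerator≡ n)) infimum
    in N , s , TailBelow.below N s s-infimum , TailBelow.covers N s s-infimum

  common-bound : a ≢ c → ∃[ s ] Below s × (∀ r → member (R a b c d) r → Covers s r)
  common-bound a≢c =
    let N , s , α≤s , s-covers = tail
        s′ , α≤s′ , s′-covers = extend N α≤s s-covers
    in s′ , α≤s′ , λ where r ((mk (suc n) , r-value) , 0<r , r≢1) → s′-covers (suc n) (s≤s z≤n) r r-value 0<r r≢1
    where
    tail : ∃[ N ] ∃[ s ] Below s × CoversFrom (suc N) s
    tail with ℕ.<-cmp a c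
    ... | tri< a<c _ _ = tail-below (ι-mono-< (ℤ.+<+ a<c))
    ... | tri≈ _ a≡c _ = contradiction a≡c a≢c
    ... | tri> _ _ c<a = tail-above (ι-mono-< (ℤ.+<+ c<a))

  k-colourable : a ≢ c → ∀ k → k ≢ 0 →
    (∀ {s} → (∀ t → lower (real α) t → t ℚ.≤ s) → 0ℚ ℚ.< s → ∀ j → k ≡ suc j → ∀ {l} → lower (real β) l → l ℚ.≤ s ^ℚ j) →
    Colourable (G a b c d) k
  k-colourable a≢c zero    k≢0 _ = contradiction refl k≢0
  k-colourable a≢c (suc j) _   β≤s^j with common-bound a≢c
  ... | s , α≤s , s-covers = log-colourable {R a b c d} 1<s λ r r∈R → interval r r∈R (s-covers r r∈R) (separated r∈R)
    where
    1<s : 1ℚ ℚ.< s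
    1<s = let t , 1<t , Lt = 1<α in ℚ.<-≤-trans 1<t (α≤s t Lt)
    0<s = ℚ.<-trans 0<1 1<s
    interval : ∀ r → member (R a b c d) r → Covers s r →
      ((∀ t → lower (real α) t → t ℚ.< r) × ∃[ l ] lower (real β) l × r ℚ.≤ l) ⊎
      ((∀ t → lower (real α) t → t ℚ.* r ℚ.< 1ℚ) × ∃[ l ] lower (real β) l × 1ℚ ℚ.≤ r ℚ.* l) →
      (s ℚ.≤ r × r ℚ.* s ℚ.≤ s ^ℚ suc j) ⊎ (r ℚ.* s ℚ.≤ 1ℚ × s ℚ.≤ s ^ℚ suc j ℚ.* r)
    interval r r∈R (inj₁ s≤r) (inj₁ (_ , l , Ll , r≤l)) =
      inj₁ (s≤r , ℚ.≤-trans (*-monoˡ-≤ (ℚ.<⇒≤ 0<s) (ℚ.≤-trans r≤l (β≤s^j α≤s 0<s j refl Ll)))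
        (ℚ.≤-reflexive (ℚ.*-comm (s ^ℚ j) s)))
    -- The mixed cases cannot occur: r > α > 1 contradicts rs ≤ 1, and below, r ≥ s > 1 contradicts
    -- αr ≤ 1.
    interval r r∈R (inj₂ rs≤1) (inj₁ (α<r , _)) =
      let t , 1<t , Lt = 1<α in contradiction
        (ℚ.<-≤-trans (1<*1< (ℚ.<-trans 1<t (α<r t Lt)) 1<s) rs≤1) (ℚ.<-irrefl refl)
    interval r r∈R (inj₁ s≤r) (inj₂ (αr<1 , _)) =
      let t , 1<t , Lt = 1<α in contradiction
        (ℚ.<-trans (1<*1< 1<t (ℚ.<-≤-trans 1<s s≤r)) (αr<1 t Lt)) (ℚ.<-irrefl refl)
    interval r r∈R (inj₂ rs≤1) (inj₂ (_ , l , Ll , 1≤rl)) = inj₂ (rs≤1 , (begin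
      s                        ≡⟨ ℚ.*-identityʳ s ⟨
      s ℚ.* 1ℚ                 ≤⟨ *-monoʳ-≤ (ℚ.<⇒≤ 0<s) 1≤rl ⟩
      s ℚ.* (r ℚ.* l)          ≤⟨ *-monoʳ-≤ (ℚ.<⇒≤ 0<s) (*-monoʳ-≤ (ℚ.<⇒≤ (member-pos (R a b c d) r∈R))
                                   (β≤s^j α≤s 0<s j refl Ll)) ⟩
      s ℚ.* (r ℚ.* s ^ℚ j)      ≡⟨ solve 3 (λ s r p → s :* (r :* p) := s :* p :* r) refl s r (s ^ℚ j) ⟩
      s ℚ.* s ^ℚ j ℚ.* r        ∎))
      where open ℚ.≤-Reasoning

-- Assembly of the three bounds

theorem2p1 :
  (a c : ℕ) .{{_ : NonZero a}} .{{_ : NonZero c}} (b d : ℤ) →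
  (a ≢ c →
    (α β : ℝ⁺) (1<α : 1ℝ <ℝ real α) (α<β : real α <ℝ real β) →
    (∀ r → member (R a b c d) r → r ∈⟨ real (β ⁻¹) , real (α ⁻¹) ⟩ ⊎ r ∈⟨ real α , real β ⟩) →
    ∀ k → ⌈ real (log⁺ (α *ℝ β) (1<* α β 1<α (<ℝ-trans {1ℝ} {real α} {real β} 1<α α<β)) /ℝ log⁺ α 1<α) ⌉≡ (+ k) →
    χ G a b c d ≤ k)
  ×
  (a ≡ c →
    ∀ p → Prime p → v p b ⊔⁺ v p d <⁺ v p (+ a) → v p b ≡ v p d →
    ∀ e → v p (b - d) ≡ [ e ] →
    χ G a b c d ≤ p ^ e * (p ∸ 1))
  ×
  (a ≡ c →
    (∃[ p ] Prime p × v p b ⊔⁺ v p d <⁺ v p (+ a) × v p b ≢ v p d) →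
    χ G a b c d ≡ 2)
theorem2p1 a c b d = part-i , part-ii , part-iii
  where
  0<ι : ∀ n .{{_ : NonZero n}} → 0ℚ ℚ.< ι (+ n)
  0<ι (suc n) = 0<ι-suc n

  part-i : a ≢ c →
    (α β : ℝ⁺) (1<α : 1ℝ <ℝ real α) (α<β : real α <ℝ real β) →
    (∀ r → member (R a b c d) r → r ∈⟨ real (β ⁻¹) , real (α ⁻¹) ⟩ ⊎ r ∈⟨ real α , real β ⟩) →
    ∀ k → ⌈ real (log⁺ (α *ℝ β) (1<* α β 1<α (<ℝ-trans {1ℝ} {real α} {real β} 1<α α<β)) /ℝ log⁺ α 1<α) ⌉≡ (+ k) →
    χ G a b c d ≤ k
  part-i a≢c α β 1<α α<β separation k (ratio≤k , _) =
    k , ℕ.≤-refl , SeparatedRatios.k-colourable (0<ι a) (0<ι c) b d α β 1<α separation a≢c k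
      (ProductBound.k≢0 α β 1<β k power-bound) (ProductBound.β≤s^[k-1] α β 1<β k power-bound)
    where
    1<β : 1ℝ <ℝ real β
    1<β = <ℝ-trans {1ℝ} {real α} {real β} 1<α α<β
    power-bound = LogRatio.power-bound (α *ℝ β) α (1<* α β 1<α 1<β) 1<α k ratio≤k

  part-ii : a ≡ c →
    ∀ p → Prime p → v p b ⊔⁺ v p d <⁺ v p (+ a) → v p b ≡ v p d →
    ∀ e → v p (b - d) ≡ [ e ] →
    χ G a b c d ≤ p ^ e * (p ∸ 1)
  part-ii refl p p-prime v[b]⊔v[d]<v[a] v[b]≡v[d] e v[b-d]≡e =
    let k , v[a]≡k = v-finite a
        i , _ , v[b]≡i , _ , i<k , _ = <⁺-finite (subst (v p b ⊔⁺ v p d <⁺_) v[a]≡k v[b]⊔v[d]<v[a])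
    in _ , ℕ.≤-refl , EqualValuations.p^e[p-1]-colourable p-prime e
         (v-exact v[a]≡k) i<k (v-exact v[b]≡i) (v-exact (trans (sym v[b]≡v[d]) v[b]≡i)) (v-exact v[b-d]≡e)
    where open Valuation p-prime

  part-iii : a ≡ c →
    (∃[ p ] Prime p × v p b ⊔⁺ v p d <⁺ v p (+ a) × v p b ≢ v p d) →
    χ G a b c d ≡ 2
  part-iii refl (p , p-prime , v[b]⊔v[d]<v[a] , v[b]≢v[d]) =
    let k , v[a]≡k = v-finite a
        i , j , v[b]≡i , v[d]≡j , i<k , j<k = <⁺-finite (subst (v p b ⊔⁺ v p d <⁺_) v[a]≡k v[b]⊔v[d]<v[a])
        -- Different valuations force b ≢ d, so the graph has an edge and one colour is not enough.
        m , n , m/n∈R = edge a b d λ b≡d → v[b]≢v[d] (cong (v p) b≡d)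
    in UnequalValuations.2-colourable p-prime (v-exact v[a]≡k) i<k j<k (v-exact v[b]≡i) (v-exact v[d]≡j)
         (λ i≡j → v[b]≢v[d] (trans v[b]≡i (trans (cong [_] i≡j) (sym v[d]≡j)))) ,
       adjacent⇒2≤ (G a b a d) {m} {n} (inj₁ m/n∈R)
    where open Valuation p-prime
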